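{- There exists a one-dimensional CA $\mathcal{A}$ such that its persistent language $L_\mu(\mathcal{A})$, with $\mu$ the uniform Bernoulli measure on its alphabet, is not a recursive (decidable) set of words.
   Context: A one-dimensional cellular automaton (CA) $\mathcal{A}$ is given by a finite alphabet $Q$, a radius $r\ge 0$ and a local rule $\delta:Q^{2r+1}\to Q$; it acts on $c\in Q^{\mathbb{Z}}$ by $\mathcal{A}(c)_i=\delta(c_{i-r},\dots,c_{i+r})$. For $u\in Q^*$, $i\in\mathbb{Z}$, $[u]_i=\{c\in Q^{\mathbb{Z}}: c_i\cdots c_{i+|u|-1}=u\}$. The uniform Bernoulli measure $\mu$ satisfies $\mu([u]_i)=|Q|^{ -|u|}$; $\mathcal{A}^n\mu(U)=\mu(\mathcal{A}^{ -n}(U))$. A word $u$ is persistent for $(\mathcal{A},\mu)$ if $\mathcal{A}^n\mu([u]_0)$ does not tend to $0$ as $n\to\infty$; $L_\mu(\mathcal{A})$ is the set of persistent words. -}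

module Defs where

open import Data.Bool.Base using (Bool; true; false; _∧_; _∨_)
open import Data.Fin.Base as Fin using (Fin; toℕ)
import Data.Fin.Properties as Fin
open import Data.Integer.Base as ℤ using (ℤ; +_; -[1+_]; 0ℤ; ∣_∣)
import Data.Integer.Properties as ℤ
open import Data.List.Base
  using (List; []; _∷_; _++_; _∷ʳ_; map; length; filterᵇ; applyUpTo; allFin; tabulate;
         cartesianProductWith)
open import Data.List.Properties using (≡-dec; map-tabulate)
open import Data.Nat.Base as ℕ using (ℕ; zero; suc; _^_; s≤s; z≤n)
open import Data.Nat.GeneralisedArithmetic using (iterate)
open import Data.Nat.ListAction using (sum)
import Data.Nat.Properties as ℕ
open import Data.Nat.Solver using (module +-*-Solver)
open import Data.Product.Base using (_×_; _,_; ∃)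
open import Data.Rational.Base as ℚ using (ℚ; 0ℚ; _/_)
import Data.Rational.Properties as ℚ
import Data.Rational.Unnormalised.Base as ℚᵘ
import Data.Rational.Unnormalised.Properties as ℚᵘ
open import Data.Sum.Base using (inj₁; inj₂)
open import Data.Vec.Base as Vec using (Vec)
import Data.Vec.Properties as Vec
open import Function.Base using (_∘_; id)
open import Relation.Binary.PropositionalEquality
open import Relation.Nullary using (¬_; does; yes; no; contradiction)

-- Alphabets are Fin (suc k): finite and nonempty.
Alphabet : ℕ → Set
Alphabet k = Fin (suc k)

Word : ℕ → Set
Word k = List (Alphabet k)

Configuration : ℕ → Set
Configuration k = ℤ → Alphabet k

-- A clopen subset of Q^ℤ (a finite union of cylinders): membership depends
-- only on the coordinates in [-bound , bound].
record Clopen (k : ℕ) : Set where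
  field
    member : Configuration k → Bool
    bound  : ℕ
    local  : ∀ c d → (∀ i → ∣ i ∣ ℕ.≤ bound → c i ≡ d i) → member c ≡ member d

open Clopen public

factor : ∀ {k} → Configuration k → ℤ → ℕ → Word k
factor c i n = applyUpTo (λ j → c (i ℤ.+ + j)) n

applyUpTo-cong< : ∀ {A : Set} {f g : ℕ → A} n →
                  (∀ j → j ℕ.< n → f j ≡ g j) → applyUpTo f n ≡ applyUpTo g n
applyUpTo-cong< zero    eq = refl
applyUpTo-cong< (suc n) eq =
  cong₂ _∷_ (eq 0 (s≤s z≤n)) (applyUpTo-cong< n (λ j j<n → eq (suc j) (s≤s j<n)))

-- [ u ]_i
cylinder : ∀ {k} → Word k → ℤ → Clopen k
cylinder u i .member c = does (≡-dec Fin._≟_ (factor c i (length u)) u)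
cylinder u i .bound    = ∣ i ∣ ℕ.+ length u
cylinder u i .local c d eq =
  cong (λ w → does (≡-dec Fin._≟_ w u))
    (applyUpTo-cong< (length u) λ j j<n →
      eq (i ℤ.+ + j)
         (ℕ.≤-trans (ℤ.∣i+j∣≤∣i∣+∣j∣ i (+ j)) (ℕ.+-monoʳ-≤ ∣ i ∣ (ℕ.<⇒≤ j<n))))

-- Measures enter only through their values on clopen sets, as the preimage
-- of a cylinder under a cellular automaton is clopen.
Measure : ℕ → Set
Measure k = Clopen k → ℚ

words : ∀ k → ℕ → List (Word k)
words k zero    = [] ∷ []
words k (suc n) = cartesianProductWith _∷_ (allFin (suc k)) (words k n)

letter : ∀ {k} → Word k → ℤ → Alphabet k
letter []      _         = Fin.zero
letter (a ∷ w) (+ zero)  = a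
letter (a ∷ w) (+ suc n) = letter w (+ n)
letter (a ∷ w) -[1+ n ]  = Fin.zero

-- A configuration carrying the word w on [-b , |w| - 1 - b]; the letters
-- elsewhere are irrelevant to a clopen set of bound b when |w| = 2b + 1.
extend : ∀ {k} → ℕ → Word k → Configuration k
extend b w i = letter w (i ℤ.+ + b)

-- The proportion of the words on the window [-bound , bound] whose cylinder
-- is contained in U; this is the measure of U, a disjoint union of these
-- cylinders, each of measure |Q|^-(2 bound + 1).  See uniform-cylinder,
-- uniform-additive and uniform-cong below.
uniform : ∀ k → Measure k
uniform k U =
  (+ length (filterᵇ (member U ∘ extend b) (words k n)) / (suc k ^ n))
    {{ℕ.m^n≢0 (suc k) n}}
  where
  b = bound U
  n = suc (2 ℕ.* b)

record CellularAutomaton : Set where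
  field
    size-1 : ℕ
    radius : ℕ
    δ      : Vec (Alphabet size-1) (suc (2 ℕ.* radius)) → Alphabet size-1

  global : Configuration size-1 → Configuration size-1
  global c i = δ (Vec.tabulate λ j → c (i ℤ.+ (toℕ j ℤ.⊖ radius)))

open CellularAutomaton public

∣m⊖r∣≤r : ∀ m r → m ℕ.≤ 2 ℕ.* r → ∣ m ℤ.⊖ r ∣ ℕ.≤ r
∣m⊖r∣≤r m r m≤2r with ℕ.≤-total m r
... | inj₁ m≤r = subst (ℕ._≤ r) (sym (ℤ.∣⊖∣-≤ m≤r)) (ℕ.m∸n≤m r m)
... | inj₂ r≤m =
  subst (ℕ._≤ r) (sym (trans (ℤ.∣m⊖n∣≡∣n⊖m∣ m r) (ℤ.∣⊖∣-≤ r≤m)))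
    (ℕ.m≤n+o⇒m∸n≤o m r (subst (λ z → m ℕ.≤ r ℕ.+ z) (ℕ.+-identityʳ r) m≤2r))

global-local : ∀ A b {c d} → (∀ i → ∣ i ∣ ℕ.≤ b ℕ.+ radius A → c i ≡ d i) →
               ∀ i → ∣ i ∣ ℕ.≤ b → global A c i ≡ global A d i
global-local A b eq i i≤b = cong (δ A) (Vec.tabulate-cong λ j →
  eq (i ℤ.+ (toℕ j ℤ.⊖ radius A))
     (ℕ.≤-trans (ℤ.∣i+j∣≤∣i∣+∣j∣ i (toℕ j ℤ.⊖ radius A))
       (ℕ.+-mono-≤ i≤b (∣m⊖r∣≤r (toℕ j) (radius A) (Fin.toℕ≤pred[n] j)))))

iterate-local : ∀ A n b {c d} → (∀ i → ∣ i ∣ ℕ.≤ b ℕ.+ n ℕ.* radius A → c i ≡ d i) →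
                ∀ i → ∣ i ∣ ℕ.≤ b → iterate (global A) c n i ≡ iterate (global A) d n i
iterate-local A zero    b eq i i≤b = eq i (subst (∣ i ∣ ℕ.≤_) (sym (ℕ.+-identityʳ b)) i≤b)
iterate-local A (suc n) b eq =
  iterate-local A n b (global-local A (b ℕ.+ n ℕ.* radius A) λ i i≤ →
    eq i (subst (∣ i ∣ ℕ.≤_)
      (trans (ℕ.+-assoc b _ _) (cong (b ℕ.+_) (ℕ.+-comm _ (radius A)))) i≤))

-- 𝒜⁻ⁿ(U)
preimage : (A : CellularAutomaton) → ℕ → Clopen (size-1 A) → Clopen (size-1 A)
preimage A n U .member c = member U (iterate (global A) c n)
preimage A n U .bound    = bound U ℕ.+ n ℕ.* radius A
preimage A n U .local c d eq = local U _ _ (iterate-local A n (bound U) eq)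

-- 𝒜ⁿμ
pushforward : (A : CellularAutomaton) → ℕ → Measure (size-1 A) → Measure (size-1 A)
pushforward A n μ U = μ (preimage A n U)

_TendsTo_ : (ℕ → ℚ) → ℚ → Set
a TendsTo l =
  ∀ ε → 0ℚ ℚ.< ε → ∃ λ N → ∀ n → N ℕ.≤ n → ℚ.∣ a n ℚ.- l ∣ ℚ.< ε

Language : ℕ → Set₁
Language k = Word k → Set

persistent : (A : CellularAutomaton) → Measure (size-1 A) → Language (size-1 A)
persistent A μ u = ¬ ((λ n → pushforward A n μ (cylinder u 0ℤ)) TendsTo 0ℚ)

data Symbol (k work : ℕ) : Set where
  blank : Symbol k work
  input : Alphabet k → Symbol k work
  aux   : Fin work → Symbol k work

data Direction : Set where
  left right : Direction

data Action (k states work : ℕ) : Set where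
  halt : (accept : Bool) → Action k states work
  go   : Fin states → Symbol k work → Direction → Action k states work

record TuringMachine (k : ℕ) : Set where
  field
    states : ℕ
    work   : ℕ
    start  : Fin states
    action : Fin states → Symbol k work → Action k states work

-- The two lists hold the tape on either side of the head, nearest cell first;
-- all cells beyond them are blank.
record Tape (k work : ℕ) : Set where
  constructor tape
  field
    lefts  : List (Symbol k work)
    head   : Symbol k work
    rights : List (Symbol k work)

move : ∀ {k work} → Direction → Tape k work → Tape k work
move left  (tape []       h rs)       = tape [] blank (h ∷ rs)
move left  (tape (l ∷ ls) h rs)       = tape ls l (h ∷ rs)
move right (tape ls       h [])       = tape (h ∷ ls) blank []
move right (tape ls       h (r ∷ rs)) = tape (h ∷ ls) r rs

write : ∀ {k work} → Symbol k work → Tape k work → Tape k work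
write s (tape ls _ rs) = tape ls s rs

initial : ∀ {k work} → Word k → Tape k work
initial []      = tape [] blank []
initial (a ∷ u) = tape [] (input a) (map input u)

module _ {k : ℕ} (M : TuringMachine k) where
  open TuringMachine M

  data HaltsFrom (q : Fin states) (t : Tape k work) (answer : Bool) : Set where
    stop : action q (Tape.head t) ≡ halt answer → HaltsFrom q t answer
    step : ∀ {q′ s dir} → action q (Tape.head t) ≡ go q′ s dir →
           HaltsFrom q′ (move dir (write s t)) answer → HaltsFrom q t answer

  Outputs : Word k → Bool → Set
  Outputs u answer = HaltsFrom start (initial u) answer

-- The characteristic function of L is computed by a Turing machine.
Recursive : ∀ {k} → Language k → Set
Recursive L = ∃ λ M → ∀ u → (L u → Outputs M u true) × (¬ L u → Outputs M u false)

-- uniform is the uniform Bernoulli measure on the clopen sets: it is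
-- extensional, finitely additive, and μ([ u ]_i) = |Q|^-|u|

open ≡-Reasoning

count : ∀ {A : Set} → (A → Bool) → List A → ℕ
count p xs = length (filterᵇ p xs)

count-++ : ∀ {A : Set} (p : A → Bool) xs ys → count p (xs ++ ys) ≡ count p xs ℕ.+ count p ys
count-++ p []       ys = refl
count-++ p (x ∷ xs) ys with p x
... | true  = cong suc (count-++ p xs ys)
... | false = count-++ p xs ys

count-map : ∀ {A B : Set} (p : B → Bool) (f : A → B) xs → count p (map f xs) ≡ count (p ∘ f) xs
count-map p f []       = refl
count-map p f (x ∷ xs) with p (f x)
... | true  = cong suc (count-map p f xs)
... | false = count-map p f xs

count-∨ : ∀ {A : Set} (p q r : A → Bool) → (∀ x → r x ≡ p x ∨ q x) → (∀ x → p x ∧ q x ≡ false) →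
          ∀ xs → count r xs ≡ count p xs ℕ.+ count q xs
count-∨ p q r or disj []       = refl
count-∨ p q r or disj (x ∷ xs) with p x | q x | r x | or x | disj x
... | true  | false | true  | _ | _ = cong suc (count-∨ p q r or disj xs)
... | false | true  | true  | _ | _ =
  trans (cong suc (count-∨ p q r or disj xs)) (sym (ℕ.+-suc _ _))
... | false | false | false | _ | _ = count-∨ p q r or disj xs

module _ {k : ℕ} where
  private
    Q = suc k

  sum-const : ∀ n {f : Fin n → ℕ} {c} → (∀ a → f a ≡ c) → sum (tabulate f) ≡ n ℕ.* c
  sum-const zero    eq = refl
  sum-const (suc n) eq = cong₂ ℕ._+_ (eq Fin.zero) (sum-const n (eq ∘ Fin.suc))

  sum-indicator : ∀ n {f : Fin n → ℕ} {c} b → f b ≡ c → (∀ a → a ≢ b → f a ≡ 0) →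
                  sum (tabulate f) ≡ c
  sum-indicator (suc n) {f} {c} Fin.zero fb fa = begin
    f Fin.zero ℕ.+ sum (tabulate (f ∘ Fin.suc)) ≡⟨ cong₂ ℕ._+_ fb (sum-const n (λ a → fa (Fin.suc a) λ ())) ⟩
    c ℕ.+ n ℕ.* 0  ≡⟨ cong (c ℕ.+_) (ℕ.*-zeroʳ n) ⟩
    c ℕ.+ 0        ≡⟨ ℕ.+-identityʳ c ⟩
    c ∎
  sum-indicator (suc n) (Fin.suc b) fb fa =
    cong₂ ℕ._+_ (fa Fin.zero λ ())
      (sum-indicator n b fb λ a a≢b → fa (Fin.suc a) (a≢b ∘ Fin.suc-injective))

  sum-ext : ∀ n {f g : Fin n → ℕ} → (∀ a → f a ≡ g a) → sum (tabulate f) ≡ sum (tabulate g)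
  sum-ext zero    eq = refl
  sum-ext (suc n) eq = cong₂ ℕ._+_ (eq Fin.zero) (sum-ext n (eq ∘ Fin.suc))

  #words : ℕ → (Word k → Bool) → ℕ
  #words n p = count p (words k n)

  #words-suc : ∀ n p → #words (suc n) p ≡ sum (tabulate λ a → #words n (p ∘ (a ∷_)))
  #words-suc n p = trans (split (allFin Q)) (cong sum (map-tabulate id (λ a → #words n (p ∘ (a ∷_)))))
    where
    split : ∀ as → count p (cartesianProductWith _∷_ as (words k n)) ≡
                sum (map (λ a → #words n (p ∘ (a ∷_))) as)
    split []       = refl
    split (a ∷ as) = trans (count-++ p (map (a ∷_) (words k n)) _)
                        (cong₂ ℕ._+_ (count-map p (a ∷_) (words k n)) (split as))

  #words-cong : ∀ n {p q} → (∀ w → length w ≡ n → p w ≡ q w) → #words n p ≡ #words n q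
  #words-cong zero {p} {q} eq with p [] | q [] | eq [] refl
  ... | true  | _ | refl = refl
  ... | false | _ | refl = refl
  #words-cong (suc n) {p} {q} eq = begin
    #words (suc n) p ≡⟨ #words-suc n p ⟩
    sum (tabulate λ a → #words n (p ∘ (a ∷_))) ≡⟨ sum-ext Q (λ a → #words-cong n λ w → eq (a ∷ w) ∘ cong suc) ⟩
    sum (tabulate λ a → #words n (q ∘ (a ∷_))) ≡⟨ #words-suc n q ⟨
    #words (suc n) q ∎

  #words-∷ : ∀ n {p q} → (∀ a w → length w ≡ n → p (a ∷ w) ≡ q w) →
             #words (suc n) p ≡ Q ℕ.* #words n q
  #words-∷ n {p} {q} eq = trans (#words-suc n p) (sum-const Q λ a → #words-cong n (eq a))

  #words-∷ʳ : ∀ n {p q} → (∀ w z → length w ≡ n → p (w ∷ʳ z) ≡ q w) →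
              #words (suc n) p ≡ Q ℕ.* #words n q
  #words-∷ʳ zero {p} {q} eq = #words-∷ zero {p} {q} λ { a [] _ → eq [] a refl }
  #words-∷ʳ (suc n) {p} {q} eq = begin
    #words (suc (suc n)) p ≡⟨ #words-suc (suc n) p ⟩
    sum (tabulate λ a → #words (suc n) (p ∘ (a ∷_)))
      ≡⟨ sum-ext Q (λ a → #words-∷ʳ n {p ∘ (a ∷_)} {q ∘ (a ∷_)} λ w z → eq (a ∷ w) z ∘ cong suc) ⟩
    sum (tabulate λ a → Q ℕ.* #words n (q ∘ (a ∷_))) ≡⟨ distr Q (λ a → #words n (q ∘ (a ∷_))) ⟩
    Q ℕ.* sum (tabulate λ a → #words n (q ∘ (a ∷_))) ≡⟨ cong (Q ℕ.*_) (#words-suc n q) ⟨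
    Q ℕ.* #words (suc n) q ∎
    where
    distr : ∀ m (f : Fin m → ℕ) → sum (tabulate λ a → Q ℕ.* f a) ≡ Q ℕ.* sum (tabulate f)
    distr zero    f = sym (ℕ.*-zeroʳ Q)
    distr (suc m) f = trans (cong (Q ℕ.* f Fin.zero ℕ.+_) (distr m (f ∘ Fin.suc)))
                            (sym (ℕ.*-distribˡ-+ Q (f Fin.zero) _))

  #words-true : ∀ n → #words n (λ _ → true) ≡ Q ^ n
  #words-true zero    = refl
  #words-true (suc n) =
    trans (#words-∷ n {q = λ _ → true} λ _ _ _ → refl) (cong (Q ℕ.*_) (#words-true n))

  occurs : Word k → ℕ → Word k → Bool
  occurs u p w = does (≡-dec Fin._≟_ (applyUpTo (λ j → letter w (+ (p ℕ.+ j))) (length u)) u)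

  #occurs : ∀ u p s → #words (p ℕ.+ (length u ℕ.+ s)) (occurs u p) ≡ Q ^ (p ℕ.+ s)
  #occurs u (suc p) s =
    trans (#words-∷ (p ℕ.+ (length u ℕ.+ s)) {occurs u (suc p)} {occurs u p} λ _ _ _ → refl)
          (cong (Q ℕ.*_) (#occurs u p s))
  #occurs []      zero s = #words-true s
  #occurs (x ∷ u) zero s = trans (#words-suc (length u ℕ.+ s) (occurs (x ∷ u) 0))
    (sum-indicator Q x (trans (#words-cong (length u ℕ.+ s) same) (#occurs u 0 s))
      λ a a≢x → trans (#words-cong (length u ℕ.+ s) {q = λ _ → false} (other a a≢x)) (none (words k (length u ℕ.+ s))))
    where
    same : ∀ w → length w ≡ _ → occurs (x ∷ u) 0 (x ∷ w) ≡ occurs u 0 w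
    same w _ with x Fin.≟ x
    ... | yes _  = refl
    ... | no x≢x = contradiction refl x≢x
    other : ∀ a → a ≢ x → ∀ w → length w ≡ _ → occurs (x ∷ u) 0 (a ∷ w) ≡ false
    other a a≢x w _ with a Fin.≟ x
    ... | yes a≡x = contradiction a≡x a≢x
    ... | no _    = refl
    none : ∀ {A : Set} (xs : List A) → count (λ _ → false) xs ≡ 0
    none []       = refl
    none (_ ∷ xs) = none xs

  #window : ℕ → Clopen k → ℕ
  #window b U = #words (suc (2 ℕ.* b)) (member U ∘ extend b)

  ∣i∣≤b⇒offset : ∀ {i} b → ∣ i ∣ ℕ.≤ b → ∃ λ m → (i ℤ.+ + b ≡ + m) × (m ℕ.≤ b ℕ.+ b)
  ∣i∣≤b⇒offset {+ n}     b n≤b = n ℕ.+ b , refl , ℕ.+-monoˡ-≤ b n≤b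
  ∣i∣≤b⇒offset { -[1+ n ]} b n<b =
    b ℕ.∸ suc n , ℤ.⊖-≥ n<b , ℕ.≤-trans (ℕ.m∸n≤m b (suc n)) (ℕ.m≤m+n b b)

  letter-∷ʳ : ∀ (w : Word k) z m → m ℕ.< length w → letter (w ∷ʳ z) (+ m) ≡ letter w (+ m)
  letter-∷ʳ (x ∷ w) z zero    _         = refl
  letter-∷ʳ (x ∷ w) z (suc m) (s≤s m<n) = letter-∷ʳ w z m m<n

  extend-suc : ∀ b a w z → length w ≡ suc (2 ℕ.* b) → ∀ i → ∣ i ∣ ℕ.≤ b →
               extend (suc b) (a ∷ (w ∷ʳ z)) i ≡ extend b w i
  extend-suc b a w z len i i≤b with ∣i∣≤b⇒offset {i} b i≤b
  ... | m , eq , m≤2b = begin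
    letter (a ∷ (w ∷ʳ z)) (i ℤ.+ + suc b) ≡⟨ cong (letter (a ∷ (w ∷ʳ z))) shift ⟩
    letter (w ∷ʳ z) (+ m)                 ≡⟨ letter-∷ʳ w z m m<len ⟩
    letter w (+ m)                        ≡⟨ cong (letter w) eq ⟨
    letter w (i ℤ.+ + b)                  ∎
    where
    shift : i ℤ.+ + suc b ≡ + suc m
    shift = begin
      i ℤ.+ (+ 1 ℤ.+ + b) ≡⟨ ℤ.+-assoc i (+ 1) (+ b) ⟨
      i ℤ.+ + 1 ℤ.+ + b   ≡⟨ cong (λ x → x ℤ.+ + b) (ℤ.+-comm i (+ 1)) ⟩
      + 1 ℤ.+ i ℤ.+ + b   ≡⟨ ℤ.+-assoc (+ 1) i (+ b) ⟩
      + 1 ℤ.+ (i ℤ.+ + b) ≡⟨ cong (ℤ._+_ (+ 1)) eq ⟩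
      + suc m ∎
    m<len : m ℕ.< length w
    m<len = subst (m ℕ.<_) (sym len)
              (s≤s (subst (m ℕ.≤_) (cong (b ℕ.+_) (sym (ℕ.+-identityʳ b))) m≤2b))

  2*suc : ∀ b → suc (2 ℕ.* suc b) ≡ suc (suc (suc (2 ℕ.* b)))
  2*suc b = cong (suc ∘ suc) (ℕ.+-suc b (b ℕ.+ 0))

  #window-suc : ∀ b U → bound U ℕ.≤ b → #window (suc b) U ≡ Q ℕ.* (Q ℕ.* #window b U)
  #window-suc b U U≤b = begin
    #window (suc b) U ≡⟨ cong (λ n → #words n p) (2*suc b) ⟩
    #words (suc (suc n)) p ≡⟨ #words-suc (suc n) p ⟩
    sum (tabulate λ a → #words (suc n) (p ∘ (a ∷_)))
      ≡⟨ sum-const Q (λ a → #words-∷ʳ n {p ∘ (a ∷_)} {member U ∘ extend b} λ w z len → local U _ _ λ i i≤ →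
           extend-suc b a w z len i (ℕ.≤-trans i≤ U≤b)) ⟩
    Q ℕ.* (Q ℕ.* #window b U) ∎
    where
    n = suc (2 ℕ.* b)
    p = member U ∘ extend (suc b)

  ratio : ℕ → ℕ → ℚ
  ratio m n = (+ m / (Q ^ n)) {{ℕ.m^n≢0 Q n}}

  ratio-cong : ∀ m n m′ n′ → m ℕ.* Q ^ n′ ≡ m′ ℕ.* Q ^ n → ratio m n ≡ ratio m′ n′
  ratio-cong m n m′ n′ eq with Q ^ n | Q ^ n′ | ℕ.m^n≢0 Q n | ℕ.m^n≢0 Q n′
  ... | suc x | suc y | _ | _ = ℚ.fromℚᵘ-cong {ℚᵘ.mkℚᵘ (+ m) x} {ℚᵘ.mkℚᵘ (+ m′) y}
    (ℚᵘ.*≡* (trans (sym (ℤ.pos-* m (suc y))) (trans (cong +_ eq) (ℤ.pos-* m′ (suc x)))))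

  ratio-+ : ∀ m m′ n → ratio (m ℕ.+ m′) n ≡ ratio m n ℚ.+ ratio m′ n
  ratio-+ m m′ n with Q ^ n | ℕ.m^n≢0 Q n
  ... | suc x | _ = ℚ.toℚᵘ-injective (ℚᵘ.≃-trans (ℚ.toℚᵘ-fromℚᵘ (ℚᵘ.mkℚᵘ (+ (m ℕ.+ m′)) x))
    (ℚᵘ.≃-trans (ℚᵘ.*≡* eq) (ℚᵘ.≃-sym (ℚᵘ.≃-trans
      (ℚ.toℚᵘ-homo-+ (ℚ.fromℚᵘ (ℚᵘ.mkℚᵘ (+ m) x)) (ℚ.fromℚᵘ (ℚᵘ.mkℚᵘ (+ m′) x)))
      (ℚᵘ.+-cong (ℚ.toℚᵘ-fromℚᵘ (ℚᵘ.mkℚᵘ (+ m) x)) (ℚ.toℚᵘ-fromℚᵘ (ℚᵘ.mkℚᵘ (+ m′) x)))))))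
    where
    d = + suc x
    eq : + (m ℕ.+ m′) ℤ.* (d ℤ.* d) ≡ (+ m ℤ.* d ℤ.+ + m′ ℤ.* d) ℤ.* d
    eq = trans (sym (ℤ.*-assoc (+ (m ℕ.+ m′)) d d)) (cong (ℤ._* d) (ℤ.*-distribʳ-+ d (+ m) (+ m′)))

  uniform-window : ∀ U d → uniform k U ≡ ratio (#window (bound U ℕ.+ d) U) (suc (2 ℕ.* (bound U ℕ.+ d)))
  uniform-window U zero = cong (λ b → ratio (#window b U) (suc (2 ℕ.* b))) (sym (ℕ.+-identityʳ (bound U)))
  uniform-window U (suc d) = begin
    uniform k U ≡⟨ uniform-window U d ⟩
    ratio c n ≡⟨ ratio-cong c n (Q ℕ.* (Q ℕ.* c)) (suc (suc n))
         (solve 3 (λ q c x → c :* (q :* (q :* x)) := q :* (q :* c) :* x) refl Q c (Q ^ n)) ⟩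
    ratio (Q ℕ.* (Q ℕ.* c)) (suc (suc n)) ≡⟨ cong₂ ratio (#window-suc b U (ℕ.m≤m+n (bound U) d)) (2*suc b) ⟨
    ratio (#window (suc b) U) (suc (2 ℕ.* suc b))
      ≡⟨ cong (λ b → ratio (#window b U) (suc (2 ℕ.* b))) (ℕ.+-suc (bound U) d) ⟨
    _ ∎
    where
    open +-*-Solver
    b = bound U ℕ.+ d
    c = #window b U
    n = suc (2 ℕ.* b)

  uniform-window-≤ : ∀ U b → bound U ℕ.≤ b → uniform k U ≡ ratio (#window b U) (suc (2 ℕ.* b))
  uniform-window-≤ U b U≤b = trans (uniform-window U (b ℕ.∸ bound U))
    (cong (λ b → ratio (#window b U) (suc (2 ℕ.* b))) (ℕ.m+[n∸m]≡n U≤b))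

  uniform-cong : ∀ U V → (∀ c → member U c ≡ member V c) → uniform k U ≡ uniform k V
  uniform-cong U V eq = begin
    uniform k U ≡⟨ uniform-window-≤ U b (ℕ.m≤m+n _ _) ⟩
    ratio (#window b U) (suc (2 ℕ.* b)) ≡⟨ cong (λ c → ratio c (suc (2 ℕ.* b)))
                       (#words-cong (suc (2 ℕ.* b)) λ w _ → eq (extend b w)) ⟩
    ratio (#window b V) (suc (2 ℕ.* b)) ≡⟨ uniform-window-≤ V b (ℕ.m≤n+m _ _) ⟨
    uniform k V ∎
    where b = bound U ℕ.+ bound V

  uniform-additive : ∀ U V W → (∀ c → member W c ≡ member U c ∨ member V c) →
                     (∀ c → member U c ∧ member V c ≡ false) →
                     uniform k W ≡ uniform k U ℚ.+ uniform k V
  uniform-additive U V W or disj = begin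
    uniform k W                             ≡⟨ uniform-window-≤ W b (ℕ.m≤n+m _ _) ⟩
    ratio (#window b W) n                   ≡⟨ cong (λ c → ratio c n) (count-∨ _ _ _
                                                 (or ∘ extend b) (disj ∘ extend b) (words k n)) ⟩
    ratio (#window b U ℕ.+ #window b V) n   ≡⟨ ratio-+ (#window b U) (#window b V) n ⟩
    ratio (#window b U) n ℚ.+ ratio (#window b V) n
      ≡⟨ cong₂ ℚ._+_ (uniform-window-≤ U b (ℕ.≤-trans (ℕ.m≤m+n (bound U) (bound V)) (ℕ.m≤m+n _ _)))
                     (uniform-window-≤ V b (ℕ.≤-trans (ℕ.m≤n+m (bound V) (bound U)) (ℕ.m≤m+n _ _))) ⟨
    uniform k U ℚ.+ uniform k V             ∎
    where
    b = bound U ℕ.+ bound V ℕ.+ bound W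
    n = suc (2 ℕ.* b)

  uniform-cylinder : ∀ u i → uniform k (cylinder u i) ≡ (+ 1 / (Q ^ length u)) {{ℕ.m^n≢0 Q (length u)}}
  uniform-cylinder u i with ∣i∣≤b⇒offset {i} (∣ i ∣ ℕ.+ length u) (ℕ.m≤m+n _ _) | bounds i
    where
    ℓ = length u
    bounds : ∀ i m → i ℤ.+ + (∣ i ∣ ℕ.+ ℓ) ≡ + m → m ℕ.+ ℓ ℕ.≤ suc (2 ℕ.* (∣ i ∣ ℕ.+ ℓ))
    bounds (+ n) .(n ℕ.+ (n ℕ.+ ℓ)) refl = ℕ.m≤n⇒m≤1+n (ℕ.≤-reflexive
      (solve 2 (λ n l → n :+ (n :+ l) :+ l := con 2 :* (n :+ l)) refl n ℓ))
      where open +-*-Solver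
    bounds -[1+ n ] m eq = ℕ.m≤n⇒m≤1+n (ℕ.≤-trans (ℕ.+-mono-≤ m≤b (ℕ.m≤n+m ℓ (suc n)))
        (ℕ.≤-reflexive (cong (b ℕ.+_) (sym (ℕ.+-identityʳ b)))))
      where
      b = suc n ℕ.+ ℓ
      m≤b : m ℕ.≤ b
      m≤b = subst (ℕ._≤ b) (ℤ.+-injective (trans (sym (ℤ.⊖-≥ (ℕ.m≤m+n (suc n) ℓ))) eq)) (ℕ.m∸n≤m b (suc n))
  ... | m , eq , _ | bd = ratio-cong (#window b (cylinder u i)) n 1 ℓ (begin
      #window b (cylinder u i) ℕ.* Q ^ ℓ ≡⟨ cong (ℕ._* Q ^ ℓ) (#words-cong n λ w _ →
          cong (λ v → does (≡-dec Fin._≟_ v u)) (applyUpTo-cong< ℓ λ j _ → cong (letter w) (pos j))) ⟩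
      #words n (occurs u m) ℕ.* Q ^ ℓ    ≡⟨ cong (λ n → #words n (occurs u m) ℕ.* Q ^ ℓ) n≡ ⟩
      #words (m ℕ.+ (ℓ ℕ.+ s)) (occurs u m) ℕ.* Q ^ ℓ ≡⟨ cong (ℕ._* Q ^ ℓ) (#occurs u m s) ⟩
      Q ^ (m ℕ.+ s) ℕ.* Q ^ ℓ            ≡⟨ ℕ.^-distribˡ-+-* Q (m ℕ.+ s) ℓ ⟨
      Q ^ (m ℕ.+ s ℕ.+ ℓ)                ≡⟨ cong (Q ^_) (trans (trans (ℕ.+-assoc m s ℓ) (cong (m ℕ.+_) (ℕ.+-comm s ℓ))) (sym n≡)) ⟩
      Q ^ n                              ≡⟨ ℕ.*-identityˡ (Q ^ n) ⟨
      1 ℕ.* Q ^ n                        ∎)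
    where
    ℓ = length u
    b = ∣ i ∣ ℕ.+ ℓ
    n = suc (2 ℕ.* b)
    s = n ℕ.∸ (m ℕ.+ ℓ)
    n≡ : n ≡ m ℕ.+ (ℓ ℕ.+ s)
    n≡ = trans (sym (ℕ.m+[n∸m]≡n (bd m eq))) (ℕ.+-assoc m ℓ s)
    pos : ∀ j → i ℤ.+ + j ℤ.+ + b ≡ + (m ℕ.+ j)
    pos j = begin
      i ℤ.+ + j ℤ.+ + b   ≡⟨ ℤ.+-assoc i (+ j) (+ b) ⟩
      i ℤ.+ (+ j ℤ.+ + b) ≡⟨ cong (λ x → i ℤ.+ x) (ℤ.+-comm (+ j) (+ b)) ⟩
      i ℤ.+ (+ b ℤ.+ + j) ≡⟨ ℤ.+-assoc i (+ b) (+ j) ⟨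
      i ℤ.+ + b ℤ.+ + j   ≡⟨ cong (λ x → x ℤ.+ + j) eq ⟩
      + (m ℕ.+ j) ∎

{-# OPTIONS --safe #-}
module Submission where

open import Defs
open import Data.Product.Base using (∃)
open import Relation.Nullary using (¬_)

import Data.Nat.Properties as ℕ
open import Algebra.Properties.CommutativeSemigroup ℕ.+-commutativeSemigroup using (x∙yz≈y∙xz)
open import Data.Bool.Base using (Bool; true; false; if_then_else_; _∧_)
open import Data.Bool.Properties using (∧-zeroʳ)
open import Data.Fin.Base as Fin using (Fin; toℕ; fromℕ; inject₁; _↑ˡ_; _↑ʳ_; combine; remQuot; splitAt)
import Data.Fin.Properties as Fin
open import Data.Integer.Base as ℤ using (+_; -[1+_]; 0ℤ)
import Data.Integer.Properties as ℤ
open import Data.List.Base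
  using (List; []; _∷_; _++_; map; length; head; applyUpTo; replicate; concat; take; drop; tabulate;
         reverse; _ʳ++_)
open import Data.List.Properties
  using (≡-dec; ∷-injective; ++-assoc; ++-identityʳ; map-++; map-∘; map-replicate; concat-++;
         take++drop≡id; length-take; length-tabulate; length-replicate; ʳ++-defn; reverse-map;
         reverse-involutive)
open import Data.List.Relation.Unary.All as All using (All; []; _∷_)
import Data.List.Relation.Unary.All.Properties as All
open import Data.Maybe.Base as Maybe using (Maybe; just; nothing)
open import Data.Maybe.Properties using (just-injective)
open import Data.Nat.Base
  using (ℕ; zero; suc; _+_; _*_; _∸_; _^_; _≤_; _<_; z≤n; s≤s; s≤s⁻¹; >-nonZero)
open import Data.Nat.GeneralisedArithmetic using (iterate)
open import Data.Nat.ListAction using (sum)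
open import Data.Nat.Solver using (module +-*-Solver)
open import Data.Product.Base as Product using (_×_; _,_; ∃₂; proj₁; proj₂)
open import Data.Rational.Base as ℚ using (mkℚ; 0ℚ)
import Data.Rational.Properties as ℚ
import Data.Rational.Unnormalised.Base as ℚᵘ
import Data.Rational.Unnormalised.Properties as ℚᵘ
open import Data.Sum.Base as Sum using (_⊎_; inj₁; inj₂; [_,_])
open import Data.Vec.Base using ([]; _∷_)
open import Function.Base using (_∘_; id; case_of_)
open import Relation.Binary.Definitions using (DecidableEquality)
open import Relation.Binary.PropositionalEquality hiding ([_])
open import Relation.Nullary using (Dec; does; yes; no; contradiction)
open import Relation.Nullary.Decidable using (dec-true; map′)

-- Vanishing has to hold for every continuation of u, which is why the program first erases what
-- follows. No rate of decay has to be estimated: a segment of length at most N is on its cycle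
-- after `suc k ^ N` steps, and a cycle on which a fault ever reaches the first cell has a fault
-- there all along. Persistence needs a single segment, closed by two walls and large enough, that
-- returns to itself: its cylinder has positive measure and shows u again at every multiple of the
-- period. Between Turing machines and segments stands a counter machine whose counters are tallies
-- of labels scattered over the cells. A sweep can move one unit without caring where it lies, and
-- since time is irrelevant, the slowdown of unary counters and unary jumps costs nothing.
-- Acceptance and rejection share one simulation. It is stated for an arbitrary property inherited
-- by predecessors, so that the number of steps of a sweep, of a jump or of T is never computed; the
-- property is later taken to be doom or the return to the start.

-- Walls cut a configuration into segments that evolve independently.  Long
-- segments are rare, so a word starting with a wall is persistent if and only if
-- it begins a segment, of some length, that recurs under the automaton.  In a
-- segment a single head works; any inconsistency becomes a fault that fills the
-- segment.  For a Turing machine T we choose a word u carrying a program that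
-- erases whatever follows u, runs T on u in the space behind u, restores the
-- segment if T rejects, and produces a fault if T accepts or space runs out.  So u
-- is persistent if T rejects u and not persistent if T accepts u, and T does not
-- decide persistence.  The program knows u because u consists of a prefix with the
-- text of the program, of n pads, and of an end marker: the text does not depend
-- on n, so n can be chosen as the code of the prefix.

-- Finite sets

record Finite (A : Set) : Set where
  field
    size          : ℕ
    index         : A → Fin size
    element       : Fin size → A
    element-index : ∀ a → element (index a) ≡ a

open Finite

finiteFin : ∀ n → Finite (Fin n)
finiteFin n = record { size = n ; index = id ; element = id ; element-index = λ _ → refl }

finite× : ∀ {A B} → Finite A → Finite B → Finite (A × B)
finite× F G = record
  { size          = size F * size G
  ; index         = λ { (a , b) → combine (index F a) (index G b) }
  ; element       = Product.map (element F) (element G) ∘ remQuot (size G)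
  ; element-index = λ { (a , b) →
      trans (cong (Product.map (element F) (element G)) (Fin.remQuot-combine (index F a) (index G b)))
            (cong₂ _,_ (element-index F a) (element-index G b)) }
  }

finite⊎ : ∀ {A B} → Finite A → Finite B → Finite (A ⊎ B)
finite⊎ F G = record
  { size          = size F + size G
  ; index         = [ (λ a → index F a ↑ˡ size G) , (λ b → size F ↑ʳ index G b) ]
  ; element       = Sum.map (element F) (element G) ∘ splitAt (size F)
  ; element-index = λ
      { (inj₁ a) → trans (cong (Sum.map (element F) (element G)) (Fin.splitAt-↑ˡ (size F) (index F a) (size G)))
                         (cong inj₁ (element-index F a))
      ; (inj₂ b) → trans (cong (Sum.map (element F) (element G)) (Fin.splitAt-↑ʳ (size F) (size G) (index G b)))
                         (cong inj₂ (element-index G b)) }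
  }

finiteRetract : ∀ {A B : Set} (f : A → B) (g : B → A) → (∀ a → g (f a) ≡ a) → Finite B → Finite A
finiteRetract f g gf F = record
  { size          = size F
  ; index         = index F ∘ f
  ; element       = g ∘ element F
  ; element-index = λ a → trans (cong g (element-index F (f a))) (gf a)
  }

finiteDirection : Finite Direction
finiteDirection = finiteRetract
  (λ { left → Fin.zero ; right → Fin.suc Fin.zero })
  (λ { Fin.zero → left ; (Fin.suc _) → right })
  (λ { left → refl ; right → refl }) (finiteFin 2)

finiteBool : Finite Bool
finiteBool = finiteRetract
  (λ { false → Fin.zero ; true → Fin.suc Fin.zero })
  (λ { Fin.zero → false ; (Fin.suc _) → true })
  (λ { false → refl ; true → refl }) (finiteFin 2)

-- Sweeping machines in a segment between two walls

-- A sequential transducer that is run over the same word again and again: turn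
-- gives the state in which the next sweep starts, and where it is undefined the
-- machine dies.
record SweepMachine : Set₁ where
  field
    State Cell  : Set
    scan        : State → Cell → State × Cell
    turn        : State → Maybe State
    finiteState : Finite State
    finiteCell  : Finite Cell

  sweep : State → List Cell → State × List Cell
  sweep q []       = q , []
  sweep q (g ∷ gs) with scan q g
  ... | q′ , g′ with sweep q′ gs
  ... | q″ , gs′ = q″ , g′ ∷ gs′

  finalState : State → List Cell → State
  finalState q w = proj₁ (sweep q w)

  rewritten : State → List Cell → List Cell
  rewritten q w = proj₂ (sweep q w)

module Segment (M : SweepMachine) where
  open SweepMachine M

  -- The letters other than the wall.  A cell knows on which side of it the
  -- head is, so that a segment with several heads or none has a local fault.
  data Content : Set where
    fault                : Content
    beforeHead afterHead : Cell → Content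
    atHead               : Direction → State → Cell → Content

  -- The number of letters is a huge numeral, which must stay unevaluated.
  abstract
    finiteContent : Finite Content
    finiteContent = finiteRetract to from from-to
      (finite⊎ (finiteFin 1) (finite⊎ finiteCell (finite⊎ finiteCell
        (finite× finiteDirection (finite× finiteState finiteCell)))))
      where
      to : Content → Fin 1 ⊎ Cell ⊎ Cell ⊎ (Direction × State × Cell)
      to fault          = inj₁ Fin.zero
      to (beforeHead g) = inj₂ (inj₁ g)
      to (afterHead g)  = inj₂ (inj₂ (inj₁ g))
      to (atHead d q g) = inj₂ (inj₂ (inj₂ (d , q , g)))
      from : Fin 1 ⊎ Cell ⊎ Cell ⊎ (Direction × State × Cell) → Content
      from (inj₁ _)                         = fault
      from (inj₂ (inj₁ g))                  = beforeHead g
      from (inj₂ (inj₂ (inj₁ g)))           = afterHead g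
      from (inj₂ (inj₂ (inj₂ (d , q , g)))) = atHead d q g
      from-to : ∀ x → from (to x) ≡ x
      from-to fault          = refl
      from-to (beforeHead g) = refl
      from-to (afterHead g)  = refl
      from-to (atHead d q g) = refl

  -- nothing stands for a wall.
  compatible : Maybe Content → Maybe Content → Bool
  compatible nothing           (just (beforeHead _))     = true
  compatible nothing           (just (atHead _ _ _))     = true
  compatible (just (beforeHead _)) (just (beforeHead _)) = true
  compatible (just (beforeHead _)) (just (atHead _ _ _)) = true
  compatible (just (atHead _ _ _)) (just (afterHead _))  = true
  compatible (just (atHead _ _ _)) nothing               = true
  compatible (just (afterHead _))  (just (afterHead _))  = true
  compatible (just (afterHead _))  nothing               = true
  compatible _                 _                         = false

  -- Only the journey to the right applies `scan`; on the way back the head carries the state chosen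
  -- by `turn` unchanged to the left wall, where the next sweep begins. An undefined `turn` is the
  -- only source of faults besides incompatible neighbours.
  update : Maybe Content → Content → Maybe Content → Content
  update l fault r = fault
  update l (beforeHead g) (just (atHead left q _)) = atHead left q g
  update l (beforeHead g) r = beforeHead g
  update (just (atHead right q g)) (afterHead g′) r = atHead right (proj₁ (scan q g)) g′
  update l (afterHead g) r = afterHead g
  update l (atHead right q g) (just _) = beforeHead (proj₂ (scan q g))
  update l (atHead right q g) nothing with turn (proj₁ (scan q g))
  ... | nothing = fault
  ... | just q′ = atHead left q′ (proj₂ (scan q g))
  update nothing  (atHead left q g) r = atHead right q g
  update (just _) (atHead left q g) r = afterHead g

  rule : Maybe Content → Content → Maybe Content → Content
  rule l x r = if compatible l (just x) ∧ compatible (just x) r then update l x r else fault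

  evolveFrom : Maybe Content → List Content → List Content
  evolveFrom l []       = []
  evolveFrom l (x ∷ xs) = rule l x (head xs) ∷ evolveFrom (just x) xs

  evolve : List Content → List Content
  evolve = evolveFrom nothing

  start : State → List Cell → List Content
  start q []       = []
  start q (g ∷ gs) = atHead right q g ∷ map afterHead gs

  -- The first cell is watched because a start word has its head there. Faults do not disappear, so
  -- a fault in the first cell rules out the start word for ever after.
  Doomed : List Content → Set
  Doomed s = ∃ λ n → head (iterate evolve s n) ≡ just fault

  incompatible-right : ∀ l {x r} → compatible (just x) r ≡ false → rule l x r ≡ fault
  incompatible-right l {x} eq rewrite eq | ∧-zeroʳ (compatible l (just x)) = refl

  compatible-faultʳ : ∀ l → compatible l (just fault) ≡ false
  compatible-faultʳ nothing               = refl
  compatible-faultʳ (just fault)          = refl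
  compatible-faultʳ (just (beforeHead _)) = refl
  compatible-faultʳ (just (afterHead _))  = refl
  compatible-faultʳ (just (atHead _ _ _)) = refl

  evolve-fault : ∀ s → head s ≡ just fault → head (evolve s) ≡ just fault
  evolve-fault (fault ∷ s) refl = refl

  iterate-fault : ∀ n s → head s ≡ just fault → head (iterate evolve s n) ≡ just fault
  iterate-fault zero    s eq = eq
  iterate-fault (suc n) s eq = iterate-fault n (evolve s) (evolve-fault s eq)

  data FaultAt : ℕ → List Content → Set where
    here  : ∀ {s} → FaultAt 0 (fault ∷ s)
    there : ∀ {n x s} → FaultAt n s → FaultAt (suc n) (x ∷ s)

  -- No content is compatible with a fault on its right, so the left neighbour of a fault is a fault
  -- one step later. The front thus travels to the left wall, one cell per step.
  fault-spreads : ∀ n l {s} → FaultAt (suc n) s → FaultAt n (evolveFrom l s)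
  fault-spreads zero l (there {x = x} (here {s})) =
    subst (λ y → FaultAt 0 (y ∷ evolveFrom (just x) (fault ∷ s)))
          (sym (incompatible-right l {x} {just fault} (compatible-faultʳ (just x)))) here
  fault-spreads (suc n) l (there f) = there (fault-spreads n _ f)

  faultAt⇒doomed : ∀ n {s} → FaultAt n s → Doomed s
  faultAt⇒doomed zero    here = 0 , refl
  faultAt⇒doomed (suc n) f    = Product.map suc id (faultAt⇒doomed n (fault-spreads n nothing f))

  evolve-doomed : ∀ {s} → Doomed (evolve s) → Doomed s
  evolve-doomed (n , eq) = suc n , eq

  -- The condition on `x` singles out the head and the cells after it. Behind such a cell only
  -- `afterHead` is compatible, so the first cell of another form turns into a fault at the next
  -- step.
  tail-or-fault : ∀ l x s → compatible (just x) nothing ≡ true →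
                  (∃ λ gs → s ≡ map afterHead gs) ⊎ (∃ λ n → FaultAt n (evolveFrom l (x ∷ s)))
  tail-or-fault l x [] c = inj₁ ([] , refl)
  tail-or-fault l x (afterHead g ∷ s) c with tail-or-fault (just x) (afterHead g) s refl
  ... | inj₁ (gs , refl) = inj₁ (g ∷ gs , refl)
  ... | inj₂ (n , f)     = inj₂ (suc n , there f)
  tail-or-fault l (atHead _ _ _) (fault ∷ s)      c     = inj₂ (1 , there here)
  tail-or-fault l (atHead _ _ _) (beforeHead _ ∷ s)   c = inj₂ (1 , there here)
  tail-or-fault l (atHead _ _ _) (atHead _ _ _ ∷ s)   c = inj₂ (1 , there here)
  tail-or-fault l (afterHead _)  (fault ∷ s)      c     = inj₂ (1 , there here)
  tail-or-fault l (afterHead _)  (beforeHead _ ∷ s)   c = inj₂ (1 , there here)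
  tail-or-fault l (afterHead _)  (atHead _ _ _ ∷ s)   c = inj₂ (1 , there here)

  tails-or-fault : ∀ l x gs s → compatible (just x) nothing ≡ true →
                   (∃ λ gs′ → s ≡ map afterHead gs′) ⊎ (∃ λ n → FaultAt n (evolveFrom l (x ∷ map afterHead gs ++ s)))
  tails-or-fault l x []       s c = tail-or-fault l x s c
  tails-or-fault l x (g ∷ gs) s c with tails-or-fault (just x) (afterHead g) gs s refl
  ... | inj₁ eq      = inj₁ eq
  ... | inj₂ (n , f) = inj₂ (suc n , there f)

  -- The cells in front of the segment are listed from right to left.
  _behind_ : List Content → List Cell → List Content
  s behind []       = s
  s behind (a ∷ as) = (beforeHead a ∷ s) behind as

  leftOf : List Cell → Maybe Content
  leftOf []      = nothing
  leftOf (a ∷ _) = just (beforeHead a)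

  -- The contents that leave a `beforeHead` cell on their left unchanged; a head on its way left
  -- would move into that cell.
  data Quiet : Content → Set where
    beforeHead : ∀ g → Quiet (beforeHead g)
    atHead     : ∀ q g → Quiet (atHead right q g)

  rule-before : ∀ as g {x} → Quiet x → rule (leftOf as) (beforeHead g) (just x) ≡ beforeHead g
  rule-before []      g (beforeHead _) = refl
  rule-before []      g (atHead _ _)   = refl
  rule-before (_ ∷ _) g (beforeHead _) = refl
  rule-before (_ ∷ _) g (atHead _ _)   = refl

  evolve-behind : ∀ as {x} s → Quiet x → evolve ((x ∷ s) behind as) ≡ evolveFrom (leftOf as) (x ∷ s) behind as
  evolve-behind []       s q = refl
  evolve-behind (a ∷ as) {x} s q = trans (evolve-behind as (x ∷ s) (beforeHead a))
    (cong (λ y → (y ∷ evolveFrom (just (beforeHead a)) (x ∷ s)) behind as) (rule-before as a q))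

  evolveFrom-after : ∀ g gs → evolveFrom (just (afterHead g)) (map afterHead gs) ≡ map afterHead gs
  evolveFrom-after g []            = refl
  evolveFrom-after g (h ∷ [])      = refl
  evolveFrom-after g (h ∷ h′ ∷ gs) = cong (afterHead h ∷_) (evolveFrom-after h (h′ ∷ gs))

  evolveFrom-at-left : ∀ q g gs → evolveFrom (just (atHead left q g)) (map afterHead gs) ≡ map afterHead gs
  evolveFrom-at-left q g []            = refl
  evolveFrom-at-left q g (h ∷ [])      = refl
  evolveFrom-at-left q g (h ∷ h′ ∷ gs) = cong (afterHead h ∷_) (evolveFrom-after h (h′ ∷ gs))

  evolve-right : ∀ as q g h gs →
    evolve ((atHead right q g ∷ afterHead h ∷ map afterHead gs) behind as) ≡
    (atHead right (proj₁ (scan q g)) h ∷ map afterHead gs) behind (proj₂ (scan q g) ∷ as)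
  evolve-right as q g h gs =
    trans (evolve-behind as _ (atHead q g)) (cong (_behind as) (cong₂ _∷_ (head-cell as) (cong₂ _∷_ (neighbour gs) (evolveFrom-after h gs))))
    where
    head-cell : ∀ as → rule (leftOf as) (atHead right q g) (just (afterHead h)) ≡ beforeHead (proj₂ (scan q g))
    head-cell []      = refl
    head-cell (_ ∷ _) = refl
    neighbour : ∀ gs → rule (just (atHead right q g)) (afterHead h) (head (map afterHead gs)) ≡ atHead right (proj₁ (scan q g)) h
    neighbour []      = refl
    neighbour (_ ∷ _) = refl

  evolve-turn : ∀ as q g {q′} → turn (proj₁ (scan q g)) ≡ just q′ →
    evolve ((atHead right q g ∷ []) behind as) ≡ (atHead left q′ (proj₂ (scan q g)) ∷ []) behind as
  evolve-turn as q g {q′} eq = trans (evolve-behind as [] (atHead q g)) (cong (λ x → (x ∷ []) behind as) (head-cell as))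
    where
    head-cell : ∀ as → rule (leftOf as) (atHead right q g) nothing ≡ atHead left q′ (proj₂ (scan q g))
    head-cell []      rewrite eq = refl
    head-cell (_ ∷ _) rewrite eq = refl

  evolve-dead : ∀ as q g → turn (proj₁ (scan q g)) ≡ nothing →
    evolve ((atHead right q g ∷ []) behind as) ≡ (fault ∷ []) behind as
  evolve-dead as q g eq = trans (evolve-behind as [] (atHead q g)) (cong (λ x → (x ∷ []) behind as) (head-cell as))
    where
    head-cell : ∀ as → rule (leftOf as) (atHead right q g) nothing ≡ fault
    head-cell []      rewrite eq = refl
    head-cell (_ ∷ _) rewrite eq = refl

  evolve-left : ∀ as q a g gs →
    evolve ((atHead left q g ∷ map afterHead gs) behind (a ∷ as)) ≡ (atHead left q a ∷ map afterHead (g ∷ gs)) behind as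
  evolve-left as q a g gs = trans (evolve-behind as _ (beforeHead a))
    (cong (_behind as) (cong₂ _∷_ (head-cell as) (cong₂ _∷_ (neighbour gs) (evolveFrom-at-left q g gs))))
    where
    head-cell : ∀ as → rule (leftOf as) (beforeHead a) (just (atHead left q g)) ≡ atHead left q a
    head-cell []      = refl
    head-cell (_ ∷ _) = refl
    neighbour : ∀ gs → rule (just (beforeHead a)) (atHead left q g) (head (map afterHead gs)) ≡ afterHead g
    neighbour []      = refl
    neighbour (_ ∷ _) = refl

  evolve-left-end : ∀ q g gs → evolve (atHead left q g ∷ map afterHead gs) ≡ atHead right q g ∷ map afterHead gs
  evolve-left-end q g gs = cong₂ _∷_ (head-cell gs) (evolveFrom-at-left q g gs)
    where
    head-cell : ∀ gs → rule nothing (atHead left q g) (head (map afterHead gs)) ≡ atHead right q g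
    head-cell []      = refl
    head-cell (_ ∷ _) = refl

  module _ (C : List Content → Set) (back : ∀ {s} → C (evolve s) → C s) where

    return : ∀ as q g gs → C (start q (as ʳ++ g ∷ gs)) → C ((atHead left q g ∷ map afterHead gs) behind as)
    return []       q g gs c = back (subst C (sym (evolve-left-end q g gs)) c)
    return (a ∷ as) q g gs c = back (subst C (sym (evolve-left as q a g gs)) (return as q a (g ∷ gs) c))

    advance : ∀ as q g gs {q′} → turn (finalState q (g ∷ gs)) ≡ just q′ →
              C (start q′ (as ʳ++ rewritten q (g ∷ gs))) → C ((atHead right q g ∷ map afterHead gs) behind as)
    advance as q g []       eq c = back (subst C (sym (evolve-turn as q g eq)) (return as _ _ [] c))
    advance as q g (h ∷ gs) eq c = back (subst C (sym (evolve-right as q g h gs)) (advance (_ ∷ as) _ h gs eq c))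

    -- A whole return journey counts as one step of the sweeping machine. Its length disappears in
    -- the induction, since `C` is only pulled back along single steps.
    sweep-back : ∀ q w {q′} → turn (finalState q w) ≡ just q′ → C (start q′ (rewritten q w)) → C (start q w)
    sweep-back q []       eq c = c
    sweep-back q (g ∷ gs) eq c = advance [] q g gs eq c

  fault-behind : ∀ as {s} → (∃ λ n → FaultAt n s) → ∃ λ n → FaultAt n (s behind as)
  fault-behind []       f       = f
  fault-behind (a ∷ as) (n , f) = fault-behind as (suc n , there f)

  die : ∀ as q g gs → turn (finalState q (g ∷ gs)) ≡ nothing →
        Doomed ((atHead right q g ∷ map afterHead gs) behind as)
  die as q g []       eq = evolve-doomed (subst Doomed (sym (evolve-dead as q g eq))
    (case fault-behind as (0 , here) of λ { (n , f) → faultAt⇒doomed n f }))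
  die as q g (h ∷ gs) eq = evolve-doomed (subst Doomed (sym (evolve-right as q g h gs)) (die (_ ∷ as) _ h gs eq))

  sweep-dead : ∀ q g gs → turn (finalState q (g ∷ gs)) ≡ nothing → Doomed (start q (g ∷ gs))
  sweep-dead q g gs = die [] q g gs

-- The uniform measure

module _ {k : ℕ} where
  private
    Q = suc k

  count-mono : ∀ {A : Set} (p q : A → Bool) → (∀ x → p x ≡ true → q x ≡ true) →
               ∀ xs → count p xs ≤ count q xs
  count-mono p q imp []       = z≤n
  count-mono p q imp (x ∷ xs) with p x | q x | imp x
  ... | true  | true  | _ = s≤s (count-mono p q imp xs)
  ... | true  | false | i = contradiction (i refl) λ ()
  ... | false | true  | _ = ℕ.m≤n⇒m≤1+n (count-mono p q imp xs)
  ... | false | false | _ = count-mono p q imp xs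

  ratio-mono : ∀ {m m′} n → m ≤ m′ → ratio {k} m n ℚ.≤ ratio {k} m′ n
  ratio-mono {m} {m′} n m≤m′ with Q ^ n | ℕ.m^n≢0 Q n
  ... | suc x | _ = ℚ.toℚᵘ-cancel-≤
    (ℚᵘ.≤-respˡ-≃ (ℚᵘ.≃-sym (ℚ.toℚᵘ-fromℚᵘ (ℚᵘ.mkℚᵘ (+ m) x)))
      (ℚᵘ.≤-respʳ-≃ (ℚᵘ.≃-sym (ℚ.toℚᵘ-fromℚᵘ (ℚᵘ.mkℚᵘ (+ m′) x)))
        (ℚᵘ.*≤* (ℤ.*-monoʳ-≤-nonNeg (+ suc x) (ℤ.+≤+ m≤m′)))))

  ratio<ε : ∀ m n p ε → ℚ.↥ ε ≡ + p → m * ℚ.↧ₙ ε < p * Q ^ n → ratio {k} m n ℚ.< ε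
  ratio<ε m n p (mkℚ (+ p) q-1 _) refl lt with Q ^ n | ℕ.m^n≢0 Q n
  ... | suc x | _ = ℚ.toℚᵘ-cancel-<
    (ℚᵘ.<-respˡ-≃ (ℚᵘ.≃-sym (ℚ.toℚᵘ-fromℚᵘ (ℚᵘ.mkℚᵘ (+ m) x)))
      (ℚᵘ.*<* (subst₂ ℤ._<_ (ℤ.pos-* m (suc q-1)) (ℤ.pos-* p (suc x)) (ℤ.+<+ lt))))

  0<ratio : ∀ m n → 0ℚ ℚ.< ratio {k} (suc m) n
  0<ratio m n with Q ^ n | ℕ.m^n≢0 Q n
  ... | suc x | _ = ℚ.toℚᵘ-cancel-<
    (ℚᵘ.<-respʳ-≃ (ℚᵘ.≃-sym (ℚ.toℚᵘ-fromℚᵘ (ℚᵘ.mkℚᵘ (+ suc m) x)))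
      (ℚᵘ.*<* (ℤ.+<+ (s≤s z≤n))))

  0≤ratio : ∀ m n → 0ℚ ℚ.≤ ratio {k} m n
  0≤ratio m n with Q ^ n | ℕ.m^n≢0 Q n
  ... | suc x | _ = ℚ.toℚᵘ-cancel-≤
    (ℚᵘ.≤-respʳ-≃ (ℚᵘ.≃-sym (ℚ.toℚᵘ-fromℚᵘ (ℚᵘ.mkℚᵘ (+ m) x)))
      (ℚᵘ.*≤* (subst (+ 0 ℤ.≤_) (ℤ.pos-* m 1) (ℤ.+≤+ z≤n))))

  uniform-mono : ∀ U V → (∀ c → member U c ≡ true → member V c ≡ true) →
                 uniform k U ℚ.≤ uniform k V
  uniform-mono U V imp = subst₂ ℚ._≤_
    (sym (uniform-window-≤ U b (ℕ.m≤m+n _ _))) (sym (uniform-window-≤ V b (ℕ.m≤n+m _ _)))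
    (ratio-mono n (count-mono (member U ∘ extend b) (member V ∘ extend b)
      (imp ∘ extend b) (words k n)))
    where
    b = bound U + bound V
    n = suc (2 * b)

  0<uniform-cylinder : ∀ u i → 0ℚ ℚ.< uniform k (cylinder u i)
  0<uniform-cylinder u i = subst (0ℚ ℚ.<_) (sym (uniform-cylinder u i)) (0<ratio 0 (length u))

  ∣uniform-0∣ : ∀ U → ℚ.∣ uniform k U ℚ.- 0ℚ ∣ ≡ uniform k U
  ∣uniform-0∣ U = trans (cong ℚ.∣_∣ (ℚ.+-identityʳ (uniform k U)))
    (ℚ.0≤p⇒∣p∣≡p (0≤ratio (#window (bound U) U) (suc (2 * bound U))))

  noZero : Word k → Bool
  noZero []              = true
  noZero (Fin.zero  ∷ w) = false
  noZero (Fin.suc _ ∷ w) = noZero w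

  avoidsZero : ℕ → Clopen k
  avoidsZero n .member c = noZero (applyUpTo (λ j → c (+ suc j)) n)
  avoidsZero n .bound    = n
  avoidsZero n .local c d eq = cong noZero (applyUpTo-cong< n λ j j<n → eq (+ suc j) j<n)

  count-false : ∀ {A : Set} (xs : List A) → count (λ _ → false) xs ≡ 0
  count-false []       = refl
  count-false (_ ∷ xs) = count-false xs

  #noZero : ∀ m n → #words {k} (m + n) (λ w → noZero (applyUpTo (λ j → letter w (+ (m + j))) n)) ≡ Q ^ m * k ^ n
  #noZero (suc m) n = begin
    #words (suc m + n) _ ≡⟨ #words-∷ (m + n) (λ _ _ _ → refl) ⟩
    Q * #words (m + n) _ ≡⟨ cong (Q *_) (#noZero m n) ⟩
    Q * (Q ^ m * k ^ n)  ≡⟨ ℕ.*-assoc Q (Q ^ m) (k ^ n) ⟨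
    Q ^ suc m * k ^ n    ∎
    where open ≡-Reasoning
  #noZero zero zero    = refl
  #noZero zero (suc n) = begin
    #words (suc n) p ≡⟨ #words-suc n p ⟩
    #words n (λ _ → false) + sum (tabulate λ a → #words n (p ∘ (Fin.suc a ∷_)))
      ≡⟨ cong₂ _+_ (count-false (words k n)) (sum-const {k} k λ a → #noZero zero n) ⟩
    k * (1 * k ^ n)  ≡⟨ cong (k *_) (ℕ.*-identityˡ (k ^ n)) ⟩
    k ^ suc n        ≡⟨ ℕ.*-identityˡ (k ^ suc n) ⟨
    1 * k ^ suc n    ∎
    where
    open ≡-Reasoning
    p : Word k → Bool
    p w = noZero (applyUpTo (λ j → letter w (+ j)) (suc n))

  uniform-avoidsZero : ∀ n → uniform k (avoidsZero n) ≡ ratio {k} (k ^ n) n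
  uniform-avoidsZero n = begin
    uniform k (avoidsZero n) ≡⟨ cong (λ c → ratio {k} c (suc (2 * n))) window ⟩
    ratio {k} (Q ^ suc n * k ^ n) (suc (2 * n))
      ≡⟨ ratio-cong (Q ^ suc n * k ^ n) (suc (2 * n)) (k ^ n) n (begin
           Q ^ suc n * k ^ n * Q ^ n ≡⟨ solve 3 (λ a b c → a :* b :* c := b :* (a :* c)) refl (Q ^ suc n) (k ^ n) (Q ^ n) ⟩
           k ^ n * (Q ^ suc n * Q ^ n) ≡⟨ cong (k ^ n *_) (ℕ.^-distribˡ-+-* Q (suc n) n) ⟨
           k ^ n * Q ^ (suc n + n)     ≡⟨ cong (λ x → k ^ n * Q ^ x) (sym 2n+1) ⟩
           k ^ n * Q ^ suc (2 * n) ∎) ⟩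
    ratio {k} (k ^ n) n ∎
    where
    open ≡-Reasoning
    open +-*-Solver
    2n+1 : suc (2 * n) ≡ suc n + n
    2n+1 = cong (λ x → suc (n + x)) (ℕ.+-identityʳ n)
    -- The `suc n` cells from `- n` to 0 are unconstrained; each of the n cells from 1 on has k
    -- choices.
    window : #window n (avoidsZero n) ≡ Q ^ suc n * k ^ n
    window = begin
      #window n (avoidsZero n) ≡⟨ #words-cong (suc (2 * n)) (λ w _ → cong noZero
          (applyUpTo-cong< n λ j _ → cong (λ x → letter w (+ suc x)) (ℕ.+-comm j n))) ⟩
      #words (suc (2 * n)) _ ≡⟨ cong (λ x → #words {k} x λ w → noZero (applyUpTo (λ j → letter w (+ (suc n + j))) n)) 2n+1 ⟩
      #words (suc n + n) _   ≡⟨ #noZero (suc n) n ⟩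
      Q ^ suc n * k ^ n      ∎

  -- Bernoulli's inequality (1 + 1/k)^n ≥ 1 + n/k, multiplied by k^(n+1) so that no division occurs.
  bernoulli : ∀ n → k ^ n * (k + n) ≤ k * Q ^ n
  bernoulli zero    = ℕ.≤-reflexive (solve 1 (λ k → con 1 :* (k :+ con 0) := k :* con 1) refl k)
    where open +-*-Solver
  bernoulli (suc n) = begin
    k * k ^ n * (k + suc n)                  ≡⟨ solve 3 (λ k x n → k :* x :* (k :+ (con 1 :+ n)) := k :* (x :* (k :+ n)) :+ x :* k) refl k (k ^ n) n ⟩
    k * (k ^ n * (k + n)) + k ^ n * k        ≤⟨ ℕ.+-mono-≤ (ℕ.*-monoʳ-≤ k (bernoulli n)) (ℕ.≤-trans (ℕ.*-monoʳ-≤ (k ^ n) (ℕ.m≤m+n k n)) (bernoulli n)) ⟩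
    k * (k * Q ^ n) + k * Q ^ n              ≡⟨ solve 2 (λ k x → k :* (k :* x) :+ k :* x := k :* ((con 1 :+ k) :* x)) refl k (Q ^ n) ⟩
    k * (Q * Q ^ n)                          ∎
    where
    open ℕ.≤-Reasoning
    open +-*-Solver

  -- If it failed, then k^n q ≥ Q^n > 0 for n = k q + 1, so k^n is positive and Bernoulli's
  -- inequality yields k + n ≤ k q after cancelling it. The exponent is chosen to exclude this.
  power-gap : ∀ p q → k ^ suc (k * q) * q < suc p * Q ^ suc (k * q)
  power-gap p q = ℕ.≰⇒> λ le → ℕ.<-irrefl refl (begin-strict
    k ^ n * (k * q)       <⟨ ℕ.*-monoʳ-< (k ^ n) {{>-nonZero (pos le)}} (ℕ.≤-trans (s≤s (ℕ.m≤n+m (k * q) k)) (ℕ.≤-reflexive (sym (ℕ.+-suc k (k * q))))) ⟩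
    k ^ n * (k + n)       ≤⟨ bernoulli n ⟩
    k * Q ^ n             ≤⟨ ℕ.*-monoʳ-≤ k (ℕ.≤-trans (ℕ.m≤n*m (Q ^ n) (suc p)) le) ⟩
    k * (k ^ n * q)       ≡⟨ solve 3 (λ k x q → k :* (x :* q) := x :* (k :* q)) refl k (k ^ n) q ⟩
    k ^ n * (k * q)       ∎)
    where
    open ℕ.≤-Reasoning
    open +-*-Solver
    n = suc (k * q)
    pos : suc p * Q ^ n ≤ k ^ n * q → 0 < k ^ n
    pos le with k ^ n
    ... | suc _ = s≤s z≤n
    ... | zero  = contradiction (ℕ.≤-trans (ℕ.m≤n*m (Q ^ n) (suc p)) le) (ℕ.<⇒≱ (ℕ.m^n>0 Q n))

  uniform-avoidsZero-vanishes : ∀ ε → 0ℚ ℚ.< ε → ∃ λ n → uniform k (avoidsZero n) ℚ.< ε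
  uniform-avoidsZero-vanishes ε@(mkℚ (+ suc p) q-1 _) _ =
    n , subst (ℚ._< ε) (sym (uniform-avoidsZero n))
          (ratio<ε (k ^ n) n (suc p) ε refl (power-gap p (suc q-1)))
    where n = suc (k * suc q-1)
  uniform-avoidsZero-vanishes (mkℚ (+ zero) q-1 c) (ℚ.*<* (ℤ.+<+ ()))
  uniform-avoidsZero-vanishes (mkℚ -[1+ p ] q-1 c) (ℚ.*<* ())

-- From segments to configurations

iterate-+ : ∀ {A : Set} (f : A → A) x m n → iterate f x (m + n) ≡ iterate f (iterate f x m) n
iterate-+ f x zero    n = refl
iterate-+ f x (suc m) n = iterate-+ f (f x) m n

iterate-suc : ∀ {A : Set} (f : A → A) x n → iterate f x (suc n) ≡ f (iterate f x n)
iterate-suc f x zero    = refl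
iterate-suc f x (suc n) = iterate-suc f (f x) n

iterate-period : ∀ {A : Set} (f : A → A) {x p} → iterate f x p ≡ x → ∀ n → iterate f x (n * p) ≡ x
iterate-period f eq zero    = refl
iterate-period f {x} {p} eq (suc n) = trans (iterate-+ f x p (n * p))
  (trans (cong (λ y → iterate f y (n * p)) eq) (iterate-period f eq n))

does-true : ∀ {P : Set} (P? : Dec P) → does P? ≡ true → P
does-true (yes p) _ = p

module Automaton (M : SweepMachine) where
  open SweepMachine M
  open Segment M

  k : ℕ
  k = size finiteContent

  encode : Content → Alphabet k
  encode x = Fin.suc (index finiteContent x)

  decode : Alphabet k → Maybe Content
  decode Fin.zero    = nothing
  decode (Fin.suc a) = just (element finiteContent a)

  decode-encode : ∀ x → decode (encode x) ≡ just x
  decode-encode x = cong just (element-index finiteContent x)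

  localRule : Alphabet k → Alphabet k → Alphabet k → Alphabet k
  localRule a Fin.zero    c = Fin.zero
  localRule a (Fin.suc b) c = encode (rule (decode a) (element finiteContent b) (decode c))

  automaton : CellularAutomaton
  automaton = record
    { size-1 = k
    ; radius = 1
    ; δ      = λ { (a ∷ b ∷ c ∷ []) → localRule a b c }
    }

  F : Configuration k → Configuration k
  F = global automaton

  right-of : Configuration k → ℕ → Alphabet k
  right-of c m = c (+ suc m)

  F-right : ∀ c m → F c (+ suc m) ≡ localRule (c (+ m)) (c (+ suc m)) (c (+ suc (suc m)))
  F-right c m = cong₂ (λ i j → localRule (c (+ m)) (c (+ i)) (c (+ j)))
    (ℕ.+-identityʳ (suc m)) (ℕ.+-comm (suc m) 1)

  -- `element` need not be injective, so several letters may stand for one content, and an arbitrary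
  -- configuration may contain any of them. After one step only letters in the image of `encode` are
  -- left besides walls; hence reappearance is claimed at positive times.
  F-canonical : ∀ c i x → decode (F c i) ≡ just x → F c i ≡ encode x
  F-canonical c i x eq = canonical
    (c (i ℤ.+ (0 ℤ.⊖ 1))) (c (i ℤ.+ (1 ℤ.⊖ 1))) (c (i ℤ.+ (2 ℤ.⊖ 1))) eq
    where
    canonical : ∀ a b c → decode (localRule a b c) ≡ just x → localRule a b c ≡ encode x
    canonical a (Fin.suc b) c eq = cong encode
      (trans (sym (element-index finiteContent y)) (just-injective eq))
      where y = rule (decode a) (element finiteContent b) (decode c)

  F-wall : ∀ c → c 0ℤ ≡ Fin.zero → F c 0ℤ ≡ Fin.zero
  F-wall c eq = cong (λ b → localRule (c (ℤ.-[1+ 0 ])) b (c (+ 1))) eq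

  -- Walls are never created, so a wall seen at time n was there at time 0 and the segment on its
  -- right can be followed from the beginning.
  F-wall⁻¹ : ∀ c → F c 0ℤ ≡ Fin.zero → c 0ℤ ≡ Fin.zero
  F-wall⁻¹ c = wall (c (ℤ.-[1+ 0 ])) (c 0ℤ) (c (+ 1))
    where
    wall : ∀ a b c → localRule a b c ≡ Fin.zero → b ≡ Fin.zero
    wall a Fin.zero c eq = refl

  data Row (f : ℕ → Alphabet k) : List Content → Set where
    wall : f 0 ≡ Fin.zero → Row f []
    cell : ∀ {x s} → decode (f 0) ≡ just x → Row (f ∘ suc) s → Row f (x ∷ s)

  Row-cong : ∀ {f g s} → (∀ m → f m ≡ g m) → Row f s → Row g s
  Row-cong eq (wall z)   = wall (trans (sym (eq 0)) z)
  Row-cong eq (cell x r) = cell (trans (cong decode (sym (eq 0))) x) (Row-cong (eq ∘ suc) r)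

  Row-head : ∀ {f s} → Row f s → decode (f 0) ≡ head s
  Row-head (wall z)   = cong decode z
  Row-head (cell x _) = x

  Row-evolveFrom : ∀ f {s} → Row (f ∘ suc) s →
                 Row (λ m → localRule (f m) (f (suc m)) (f (suc (suc m)))) (evolveFrom (decode (f 0)) s)
  Row-evolveFrom f (wall z)   = wall (cong (λ b → localRule (f 0) b (f 2)) z)
  Row-evolveFrom f {x ∷ s} (cell eq r) = cell (centre (f 1) eq) 
    (subst (λ l → Row (λ m → localRule (f (suc m)) (f (suc (suc m))) (f (suc (suc (suc m))))) (evolveFrom l s)) eq
      (Row-evolveFrom (f ∘ suc) r))
    where
    centre : ∀ b → decode b ≡ just x → decode (localRule (f 0) b (f 2)) ≡ just (rule (decode (f 0)) x (head s))
    centre (Fin.suc b) refl = trans (decode-encode (rule (decode (f 0)) x (decode (f 2))))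
      (cong (λ y → just (rule (decode (f 0)) x y)) (Row-head r))

  Row-iterate : ∀ n c {s} → c 0ℤ ≡ Fin.zero → Row (right-of c) s →
                Row (right-of (iterate F c n)) (iterate evolve s n)
  Row-iterate zero    c z r = r
  Row-iterate (suc n) c {s} z r = Row-iterate n (F c) (F-wall c z)
    (Row-cong (sym ∘ F-right c)
      (subst (λ a → Row (λ m → localRule (c (+ m)) (c (+ suc m)) (c (+ suc (suc m)))) (evolveFrom (decode a) s)) z
        (Row-evolveFrom (λ m → c (+ m)) r)))

  iterate-wall : ∀ n c → c 0ℤ ≡ Fin.zero → iterate F c n 0ℤ ≡ Fin.zero
  iterate-wall zero    c z = z
  iterate-wall (suc n) c z = iterate-wall n (F c) (F-wall c z)

  iterate-wall⁻¹ : ∀ n c → iterate F c n 0ℤ ≡ Fin.zero → c 0ℤ ≡ Fin.zero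
  iterate-wall⁻¹ zero    c z = z
  iterate-wall⁻¹ (suc n) c z = F-wall⁻¹ c (iterate-wall⁻¹ n (F c) z)

  -- The dichotomy behind the decay: either the configuration lies in the rare set `avoidsZero n`,
  -- or its segment is short enough for its cycle to be controlled.
  firstRow : ∀ n (f : ℕ → Alphabet k) →
             noZero (applyUpTo f n) ≡ true ⊎ (∃ λ s → Row f s × length s ≤ n)
  firstRow zero    f = inj₁ refl
  firstRow (suc n) f = first (f 0) refl
    where
    first : ∀ a → f 0 ≡ a → noZero (a ∷ applyUpTo (f ∘ suc) n) ≡ true ⊎ (∃ λ s → Row f s × length s ≤ suc n)
    first Fin.zero    eq = inj₂ ([] , wall eq , z≤n)
    first (Fin.suc a) eq with firstRow n (f ∘ suc)
    ... | inj₁ none         = inj₁ none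
    ... | inj₂ (s , r , le) = inj₂ (_ ∷ s , cell (cong decode eq) r , s≤s le)

  Row-prefix : ∀ {f s} t → Row f s → applyUpTo f (length (map encode t)) ≡ map encode t →
               ∃ λ r → s ≡ t ++ r
  Row-prefix []      r          eq = _ , refl
  Row-prefix (x ∷ t) (wall z)   eq with trans (sym z) (proj₁ (∷-injective eq))
  ... | ()
  Row-prefix (x ∷ t) (cell y r) eq with Row-prefix t r (proj₂ (∷-injective eq))
  ... | rest , eq′ = rest , cong₂ _∷_
    (just-injective (trans (sym y) (trans (cong decode (proj₁ (∷-injective eq))) (decode-encode x)))) eq′

  Row-factor : ∀ {f} t {r} → (∀ m x → decode (f m) ≡ just x → f m ≡ encode x) → Row f (t ++ r) →
               applyUpTo f (length (map encode t)) ≡ map encode t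
  Row-factor []      canonical r          = refl
  Row-factor (x ∷ t) canonical (cell y r) = cong₂ _∷_ (canonical 0 x y) (Row-factor t (canonical ∘ suc) r)

  factor-Row : ∀ {f} t → applyUpTo f (length (map encode t ++ Fin.zero ∷ [])) ≡ map encode t ++ Fin.zero ∷ [] →
               Row f t
  factor-Row []      eq = wall (proj₁ (∷-injective eq))
  factor-Row (x ∷ t) eq = cell (trans (cong decode (proj₁ (∷-injective eq))) (decode-encode x))
                               (factor-Row t (proj₂ (∷-injective eq)))

  -- Eventual periodicity and the decay of doomed words

  code : ∀ m → List Content → Fin (suc k ^ m)
  code zero    _       = Fin.zero
  code (suc m) []      = combine {suc k} Fin.zero (code m [])
  code (suc m) (x ∷ s) = combine {suc k} (encode x) (code m s)

  code-injective : ∀ m {s t} → length s ≡ m → length t ≡ m → code m s ≡ code m t → s ≡ t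
  code-injective zero    {[]}    {[]}    _ _ _ = refl
  code-injective (suc m) {x ∷ s} {y ∷ t} p q eq
    with Fin.combine-injective (encode x) (code m s) (encode y) (code m t) eq
  ... | eq₁ , eq₂ = cong₂ _∷_
    (just-injective (trans (sym (decode-encode x)) (trans (cong decode eq₁) (decode-encode y))))
    (code-injective m (ℕ.suc-injective p) (ℕ.suc-injective q) eq₂)

  length-evolveFrom : ∀ l s → length (evolveFrom l s) ≡ length s
  length-evolveFrom l []      = refl
  length-evolveFrom l (x ∷ s) = cong suc (length-evolveFrom (just x) s)

  length-iterate : ∀ n s → length (iterate evolve s n) ≡ length s
  length-iterate zero    s = refl
  length-iterate (suc n) s = trans (length-iterate n (evolve s)) (length-evolveFrom nothing s)

  -- Among the times 0 to K two give the same segment, as there are at most K codes of this length.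
  -- From the earlier one on the orbit is periodic, and n is no earlier than that.
  eventually-periodic : ∀ s n → suc k ^ length s ≤ n →
                        ∃ λ p → iterate evolve (iterate evolve s n) (suc p) ≡ iterate evolve s n
  eventually-periodic s n K≤n with Fin.pigeonhole (ℕ.n<1+n K) (λ i → code (length s) (iterate evolve s (toℕ i)))
    where K = suc k ^ length s
  ... | i , j , i<j , eq = toℕ j ∸ suc (toℕ i) , (begin
    iterate evolve (iterate evolve s n) (suc p) ≡⟨ iterate-+ evolve s n (suc p) ⟨
    iterate evolve s (n + suc p)              ≡⟨ cong (iterate evolve s) n+p ⟩
    iterate evolve s (toℕ j + r)              ≡⟨ iterate-+ evolve s (toℕ j) r ⟩
    iterate evolve (iterate evolve s (toℕ j)) r ≡⟨ cong (λ t → iterate evolve t r) same ⟨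
    iterate evolve (iterate evolve s (toℕ i)) r ≡⟨ iterate-+ evolve s (toℕ i) r ⟨
    iterate evolve s (toℕ i + r)              ≡⟨ cong (iterate evolve s) (ℕ.m+[n∸m]≡n i≤n) ⟩
    iterate evolve s n                        ∎)
    where
    open ≡-Reasoning
    p = toℕ j ∸ suc (toℕ i)
    r = n ∸ toℕ i
    i≤n : toℕ i ≤ n
    i≤n = ℕ.≤-trans (ℕ.≤-trans (ℕ.<⇒≤ i<j) (Fin.toℕ≤pred[n] j)) K≤n
    same : iterate evolve s (toℕ i) ≡ iterate evolve s (toℕ j)
    same = code-injective (length s) (length-iterate (toℕ i) s) (length-iterate (toℕ j) s) eq
    n+p : n + suc p ≡ toℕ j + r
    n+p = begin
      n + suc p                   ≡⟨ cong (λ x → x + suc p) (ℕ.m+[n∸m]≡n i≤n) ⟨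
      toℕ i + r + suc p           ≡⟨ ℕ.+-assoc (toℕ i) r (suc p) ⟩
      toℕ i + (r + suc p)         ≡⟨ cong (λ x → toℕ i + x) (ℕ.+-comm r (suc p)) ⟩
      toℕ i + (suc p + r)         ≡⟨ ℕ.+-assoc (toℕ i) (suc p) r ⟨
      toℕ i + suc p + r           ≡⟨ cong (λ x → x + r) (trans (ℕ.+-suc (toℕ i) p) (ℕ.m+[n∸m]≡n i<j)) ⟩
      toℕ j + r                   ∎

  -- If the fault shows after n steps, it is still there `n * p` steps later. By then n full periods
  -- have passed and the segment is `t` again.
  periodic-doomed : ∀ t p → iterate evolve t (suc p) ≡ t → Doomed t → head t ≡ just fault
  periodic-doomed t p period (n , eq) = subst (λ s → head s ≡ just fault)
    (trans (sym (iterate-+ evolve t n (n * p)))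
      (trans (cong (iterate evolve t) (sym (ℕ.*-suc n p))) (iterate-period evolve period n)))
    (iterate-fault (n * p) (iterate evolve t n) eq)

  startWord : State → List Cell → Word k
  startWord q w = Fin.zero ∷ map encode (start q w)

  -- What follows the word is arbitrary. Either it consists of `afterHead` cells and the hypothesis
  -- applies, or it contains a local inconsistency whose fault travels to the first cell.
  start-doomed : ∀ q g gs → (∀ hs → Doomed (start q (g ∷ gs ++ hs))) →
                 ∀ r → Doomed (start q (g ∷ gs) ++ r)
  start-doomed q g gs doomed r with tails-or-fault nothing (atHead right q g) gs r refl
  ... | inj₁ (hs , refl) = subst (λ s → Doomed (atHead right q g ∷ s)) (map-++ afterHead gs hs) (doomed hs)
  ... | inj₂ (n , f)     = evolve-doomed (faultAt⇒doomed n f)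

  occurrence : ∀ (c : Configuration k) (u : Word k) → member (cylinder u 0ℤ) c ≡ true → applyUpTo (λ j → c (+ j)) (length u) ≡ u
  occurrence c u = does-true (≡-dec Fin._≟_ (factor c 0ℤ (length u)) u)

  -- At so late a time the segment is on its cycle. A doomed segment on a cycle has a fault in
  -- front, whereas a start word has its head there.
  no-late-start : ∀ q g gs → (∀ hs → Doomed (start q (g ∷ gs ++ hs))) →
                  ∀ n s → suc k ^ length s ≤ n → ∀ r → iterate evolve s n ≢ start q (g ∷ gs) ++ r
  no-late-start q g gs doomed n s K≤n r eq with eventually-periodic s n K≤n
  ... | p , period with periodic-doomed (start q (g ∷ gs) ++ r) p
                          (subst (λ t → iterate evolve t (suc p) ≡ t) eq period) (start-doomed q g gs doomed r)
  ... | ()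

  -- Seen after `suc k ^ N` steps, the word cannot begin a segment of length at most N. So the
  -- preimage lies in `avoidsZero N`, and N is chosen to make the measure of that set less than `ε`.
  tendsTo0 : ∀ q g gs → (∀ hs → Doomed (start q (g ∷ gs ++ hs))) →
             (λ n → pushforward automaton n (uniform k) (cylinder (startWord q (g ∷ gs)) 0ℤ)) TendsTo 0ℚ
  tendsTo0 q g gs doomed ε 0<ε = bound-from (uniform-avoidsZero-vanishes ε 0<ε)
    where
    u = startWord q (g ∷ gs)
    U = cylinder u 0ℤ
    avoid : ∀ N n → suc k ^ N ≤ n → ∀ c → member (preimage automaton n U) c ≡ true → member (avoidsZero N) c ≡ true
    avoid N n T≤n c mem = fromFirst (firstRow N (right-of c))
      where
      occ : applyUpTo (λ j → iterate F c n (+ j)) (length u) ≡ u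
      occ = occurrence (iterate F c n) u mem
      fromFirst : noZero (applyUpTo (right-of c) N) ≡ true ⊎ (∃ λ s → Row (right-of c) s × length s ≤ N) →
                  noZero (applyUpTo (right-of c) N) ≡ true
      fromFirst (inj₁ none) = none
      fromFirst (inj₂ (s , row , len)) = contradiction (proj₂ pre)
        (no-late-start q g gs doomed n s (ℕ.≤-trans (ℕ.^-monoʳ-≤ (suc k) len) T≤n) (proj₁ pre))
        where
        pre : ∃ λ r → iterate evolve s n ≡ start q (g ∷ gs) ++ r
        pre = Row-prefix (start q (g ∷ gs))
          (Row-iterate n c (iterate-wall⁻¹ n c (proj₁ (∷-injective occ))) row) (proj₂ (∷-injective occ))
    bound-from : (∃ λ N → uniform k (avoidsZero N) ℚ.< ε) →
                 ∃ λ T → ∀ n → T ≤ n → ℚ.∣ uniform k (preimage automaton n U) ℚ.- 0ℚ ∣ ℚ.< ε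
    bound-from (N , lt) = suc k ^ N , λ n T≤n → subst (ℚ._< ε) (sym (∣uniform-0∣ (preimage automaton n U)))
      (ℚ.≤-<-trans (uniform-mono (preimage automaton n U) (avoidsZero N) (avoid N n T≤n)) lt)

  -- Persistence of recurrent words

  segmentWord : List Content → Word k
  segmentWord s = Fin.zero ∷ map encode s ++ Fin.zero ∷ []

  reappearance : ∀ s t r m → iterate evolve s (suc m) ≡ t ++ r →
                 ∀ c → member (cylinder (segmentWord s) 0ℤ) c ≡ true →
                 member (preimage automaton (suc m) (cylinder (Fin.zero ∷ map encode t) 0ℤ)) c ≡ true
  reappearance s t r m eq c mem = dec-true (≡-dec Fin._≟_ (factor d 0ℤ (suc (length (map encode t)))) (Fin.zero ∷ map encode t))
    (cong₂ _∷_ (iterate-wall (suc m) c z) (Row-factor t canonical row))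
    where
    d : Configuration k
    d = iterate F c (suc m)
    occ : applyUpTo (λ j → c (+ j)) (length (segmentWord s)) ≡ segmentWord s
    occ = occurrence c (segmentWord s) mem
    z : c 0ℤ ≡ Fin.zero
    z = proj₁ (∷-injective occ)
    row : Row (right-of d) (t ++ r)
    row = subst (Row (right-of d)) eq (Row-iterate (suc m) c z (factor-Row s (proj₂ (∷-injective occ))))
    canonical : ∀ i x → decode (right-of d i) ≡ just x → right-of d i ≡ encode x
    canonical i x = subst (λ d → decode (right-of d i) ≡ just x → right-of d i ≡ encode x)
      (sym (iterate-suc F c m)) (F-canonical (iterate F c m) (+ suc i) x)

  -- The measure of the cylinder of `w` is positive and bounds the sequence from below infinitely
  -- often, so it serves as the `ε` that refutes convergence to 0.
  bounded-below⇒persistent : ∀ (u w : Word k) →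
    (∀ N → ∃ λ n → N ≤ n × (∀ c → member (cylinder w 0ℤ) c ≡ true →
                                   member (preimage automaton n (cylinder u 0ℤ)) c ≡ true)) →
    persistent automaton (uniform k) u
  bounded-below⇒persistent u w often tends = absurd (tends (uniform k (cylinder w 0ℤ)) (0<uniform-cylinder w 0ℤ))
    where
    absurd : ¬ ∃ λ N → ∀ n → N ≤ n →
             ℚ.∣ uniform k (preimage automaton n (cylinder u 0ℤ)) ℚ.- 0ℚ ∣ ℚ.< uniform k (cylinder w 0ℤ)
    absurd (N , small) = compare (often N)
      where
      compare : ¬ ∃ λ n → N ≤ n × (∀ c → member (cylinder w 0ℤ) c ≡ true →
                                         member (preimage automaton n (cylinder u 0ℤ)) c ≡ true)
      compare (n , N≤n , imp) = ℚ.<-irrefl refl (ℚ.≤-<-trans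
        (uniform-mono (cylinder w 0ℤ) (preimage automaton n (cylinder u 0ℤ)) imp)
        (subst (ℚ._< uniform k (cylinder w 0ℤ)) (∣uniform-0∣ (preimage automaton n (cylinder u 0ℤ))) (small n N≤n)))

  recurrent⇒persistent : ∀ q g gs hs p → iterate evolve (start q (g ∷ gs ++ hs)) (suc p) ≡ start q (g ∷ gs ++ hs) →
                         persistent automaton (uniform k) (startWord q (g ∷ gs))
  recurrent⇒persistent q g gs hs p period = bounded-below⇒persistent (startWord q (g ∷ gs)) (segmentWord s) λ N →
    suc N * suc p , ℕ.≤-trans (ℕ.n≤1+n N) (ℕ.m≤m*n (suc N) (suc p)) ,
    -- The number passed is the predecessor of the time `suc N * suc p`, to which
    -- `suc (p + N * suc p)` is equal by computation.
    reappearance s (start q (g ∷ gs)) (map afterHead hs) (p + N * suc p)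
      (trans (iterate-period evolve {p = suc p} period (suc N)) (cong (atHead right q g ∷_) (map-++ afterHead gs hs)))
    where
    s : List Content
    s = start q (g ∷ gs ++ hs)

  record Persists (q : State) (w : List Cell) : Set where
    constructor persisting
    field
      persists : persistent automaton (uniform k) (startWord q w)

  record Vanishes (q : State) (w : List Cell) : Set where
    constructor vanishing
    field
      vanishes : (λ n → pushforward automaton n (uniform k) (cylinder (startWord q w) 0ℤ)) TendsTo 0ℚ

  doomed⇒vanishes : ∀ q w → w ≢ [] → (∀ hs → Doomed (start q (w ++ hs))) → Vanishes q w
  doomed⇒vanishes q []       ne doomed = contradiction refl ne
  doomed⇒vanishes q (g ∷ gs) ne doomed = vanishing (tendsTo0 q g gs doomed)

  recurrent⇒persists : ∀ q w → w ≢ [] → ∀ hs p →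
    iterate evolve (start q (w ++ hs)) (suc p) ≡ start q (w ++ hs) → Persists q w
  recurrent⇒persists q []       ne hs p period = contradiction refl ne
  recurrent⇒persists q (g ∷ gs) ne hs p period = persisting (recurrent⇒persistent q g gs hs p period)

  Diagonal : TuringMachine k → State → List Cell → Set
  Diagonal T q w = (Outputs T (startWord q w) true → Vanishes q w) ×
                   (Outputs T (startWord q w) false → Persists q w)

  -- The argument is constructive, without a case distinction on the answer of `T`. If the word were
  -- persistent, `T` would accept it and it would vanish; so it is not persistent, hence `T` rejects
  -- it, and it is persistent after all.
  diagonalisation : (∀ T → ∃ λ q → ∃ λ w → Diagonal T q w) → ¬ Recursive (persistent automaton (uniform k))
  diagonalisation diagonal (T , decides) = refute (diagonal T)
    where
    refute : ¬ ∃ λ q → ∃ λ w → Diagonal T q w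
    refute (q , w , accepted , rejected) = not-persistent
      (Persists.persists (rejected (proj₂ (decides (startWord q w)) not-persistent)))
      where
      not-persistent : ¬ persistent automaton (uniform k) (startWord q w)
      not-persistent p = p (Vanishes.vanishes (accepted (proj₁ (decides (startWord q w)) p)))

-- A universal sweeping machine

data Counter : Set where
  stack      : Direction → Counter
  temp spare : Counter

-- The value of a counter is the number of cells labelled with it.  The label
-- jump counts the instructions still to be skipped by a jump.
data Label : Set where
  free jump : Label
  counter   : Counter → Label

data Delimiter : Set where
  otherwise separator : Delimiter

-- Kinds hold the program and stay as they are while it runs. The data lie in the labels, which
-- every cell carries whatever its kind. `op i j` requests that one cell labelled `i` become
-- labelled `j`.
data Kind : Set where
  op                      : Label → Label → Kind
  delimiter               : Delimiter → Kind
  stop die pad end vacant : Kind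

finiteCounter : Finite Counter
finiteCounter = finiteRetract
  (λ { (stack d) → inj₁ d ; temp → inj₂ Fin.zero ; spare → inj₂ (Fin.suc Fin.zero) })
  (λ { (inj₁ d) → stack d ; (inj₂ Fin.zero) → temp ; (inj₂ (Fin.suc _)) → spare })
  (λ { (stack d) → refl ; temp → refl ; spare → refl })
  (finite⊎ finiteDirection (finiteFin 2))

finiteLabel : Finite Label
finiteLabel = finiteRetract
  (λ { free → inj₁ Fin.zero ; jump → inj₁ (Fin.suc Fin.zero) ; (counter c) → inj₂ c })
  (λ { (inj₁ Fin.zero) → free ; (inj₁ (Fin.suc _)) → jump ; (inj₂ c) → counter c })
  (λ { free → refl ; jump → refl ; (counter c) → refl })
  (finite⊎ (finiteFin 2) finiteCounter)

finiteDelimiter : Finite Delimiter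
finiteDelimiter = finiteRetract
  (λ { otherwise → false ; separator → true }) (λ { false → otherwise ; true → separator })
  (λ { otherwise → refl ; separator → refl }) finiteBool

finiteKind : Finite Kind
finiteKind = finiteRetract to from from-to
  (finite⊎ (finite× finiteLabel finiteLabel) (finite⊎ finiteDelimiter (finiteFin 5)))
  where
  to : Kind → (Label × Label) ⊎ Delimiter ⊎ Fin 5
  to (op i j)      = inj₁ (i , j)
  to (delimiter d) = inj₂ (inj₁ d)
  to stop          = inj₂ (inj₂ Fin.zero)
  to die           = inj₂ (inj₂ (Fin.suc Fin.zero))
  to pad           = inj₂ (inj₂ (Fin.suc (Fin.suc Fin.zero)))
  to end           = inj₂ (inj₂ (Fin.suc (Fin.suc (Fin.suc Fin.zero))))
  to vacant        = inj₂ (inj₂ (Fin.suc (Fin.suc (Fin.suc (Fin.suc Fin.zero)))))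
  from : (Label × Label) ⊎ Delimiter ⊎ Fin 5 → Kind
  from (inj₁ (i , j))                                               = op i j
  from (inj₂ (inj₁ d))                                              = delimiter d
  from (inj₂ (inj₂ Fin.zero))                                       = stop
  from (inj₂ (inj₂ (Fin.suc Fin.zero)))                             = die
  from (inj₂ (inj₂ (Fin.suc (Fin.suc Fin.zero))))                   = pad
  from (inj₂ (inj₂ (Fin.suc (Fin.suc (Fin.suc Fin.zero)))))         = end
  from (inj₂ (inj₂ (Fin.suc (Fin.suc (Fin.suc (Fin.suc _))))))      = vacant
  from-to : ∀ κ → from (to κ) ≡ κ
  from-to (op i j)      = refl
  from-to (delimiter d) = refl
  from-to stop          = refl
  from-to die           = refl
  from-to pad           = refl
  from-to end           = refl
  from-to vacant        = refl

-- The flag marks the cell of the program to be executed next.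
Tag : Set
Tag = Kind × Bool

TaggedCell : Set
TaggedCell = Tag × Label

-- The sweeps that look at the tags only.  The flag of put and done says
-- whether the mark was moved by a jump.
data MarkState : Set where
  fetch step₀ reset₀ reset₁ : MarkState
  got                       : Kind → MarkState
  skip₀ skip₁               : Delimiter → MarkState
  put done                  : Bool → MarkState

-- The norm states rewrite the word into its initial form.  The program starts
-- after such a sweep with flag true, and halts with one of flag false followed by
-- one of flag true: the first turns the segment into the initial one, on which the
-- second is about to start as at the beginning.
data UState : Set where
  mark              : MarkState → UState
  relabel           : Label → Label → UState
  relabelled        : Label → UState
  norm₀ norm₁ norm₂ : Bool → UState

finiteMarkState : Finite MarkState
finiteMarkState = finiteRetract to from from-to
  (finite⊎ (finiteFin 4) (finite⊎ finiteKind (finite⊎ (finite× finiteBool finiteDelimiter) (finite× finiteBool finiteBool))))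
  where
  to : MarkState → Fin 4 ⊎ Kind ⊎ (Bool × Delimiter) ⊎ (Bool × Bool)
  to fetch     = inj₁ Fin.zero
  to step₀     = inj₁ (Fin.suc Fin.zero)
  to reset₀    = inj₁ (Fin.suc (Fin.suc Fin.zero))
  to reset₁    = inj₁ (Fin.suc (Fin.suc (Fin.suc Fin.zero)))
  to (got κ)   = inj₂ (inj₁ κ)
  to (skip₀ d) = inj₂ (inj₂ (inj₁ (false , d)))
  to (skip₁ d) = inj₂ (inj₂ (inj₁ (true , d)))
  to (put b)   = inj₂ (inj₂ (inj₂ (false , b)))
  to (done b)  = inj₂ (inj₂ (inj₂ (true , b)))
  from : Fin 4 ⊎ Kind ⊎ (Bool × Delimiter) ⊎ (Bool × Bool) → MarkState
  from (inj₁ Fin.zero)                            = fetch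
  from (inj₁ (Fin.suc Fin.zero))                  = step₀
  from (inj₁ (Fin.suc (Fin.suc Fin.zero)))        = reset₀
  from (inj₁ (Fin.suc (Fin.suc (Fin.suc _))))     = reset₁
  from (inj₂ (inj₁ κ))                            = got κ
  from (inj₂ (inj₂ (inj₁ (false , d))))           = skip₀ d
  from (inj₂ (inj₂ (inj₁ (true , d))))            = skip₁ d
  from (inj₂ (inj₂ (inj₂ (false , b))))           = put b
  from (inj₂ (inj₂ (inj₂ (true , b))))            = done b
  from-to : ∀ m → from (to m) ≡ m
  from-to fetch     = refl
  from-to step₀     = refl
  from-to reset₀    = refl
  from-to reset₁    = refl
  from-to (got κ)   = refl
  from-to (skip₀ d) = refl
  from-to (skip₁ d) = refl
  from-to (put b)   = refl
  from-to (done b)  = refl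

finiteUState : Finite UState
finiteUState = finiteRetract to from from-to
  (finite⊎ finiteMarkState (finite⊎ (finite× finiteLabel finiteLabel) (finite⊎ finiteLabel (finite× (finiteFin 3) finiteBool))))
  where
  to : UState → MarkState ⊎ (Label × Label) ⊎ Label ⊎ (Fin 3 × Bool)
  to (mark m)       = inj₁ m
  to (relabel i j)  = inj₂ (inj₁ (i , j))
  to (relabelled i) = inj₂ (inj₂ (inj₁ i))
  to (norm₀ b)      = inj₂ (inj₂ (inj₂ (Fin.zero , b)))
  to (norm₁ b)      = inj₂ (inj₂ (inj₂ (Fin.suc Fin.zero , b)))
  to (norm₂ b)      = inj₂ (inj₂ (inj₂ (Fin.suc (Fin.suc Fin.zero) , b)))
  from : MarkState ⊎ (Label × Label) ⊎ Label ⊎ (Fin 3 × Bool) → UState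
  from (inj₁ m)                                           = mark m
  from (inj₂ (inj₁ (i , j)))                              = relabel i j
  from (inj₂ (inj₂ (inj₁ i)))                             = relabelled i
  from (inj₂ (inj₂ (inj₂ (Fin.zero , b))))                = norm₀ b
  from (inj₂ (inj₂ (inj₂ (Fin.suc Fin.zero , b))))        = norm₁ b
  from (inj₂ (inj₂ (inj₂ (Fin.suc (Fin.suc _) , b))))     = norm₂ b
  from-to : ∀ q → from (to q) ≡ q
  from-to (mark m)       = refl
  from-to (relabel i j)  = refl
  from-to (relabelled i) = refl
  from-to (norm₀ b)      = refl
  from-to (norm₁ b)      = refl
  from-to (norm₂ b)      = refl

_≟ᵈ_ : DecidableEquality Direction
left  ≟ᵈ left  = yes refl
left  ≟ᵈ right = no λ ()
right ≟ᵈ left  = no λ ()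
right ≟ᵈ right = yes refl

_≟ᶜ_ : DecidableEquality Counter
stack d ≟ᶜ stack e = map′ (cong stack) (λ { refl → refl }) (d ≟ᵈ e)
stack _ ≟ᶜ temp    = no λ ()
stack _ ≟ᶜ spare   = no λ ()
temp    ≟ᶜ stack _ = no λ ()
temp    ≟ᶜ temp    = yes refl
temp    ≟ᶜ spare   = no λ ()
spare   ≟ᶜ stack _ = no λ ()
spare   ≟ᶜ temp    = no λ ()
spare   ≟ᶜ spare   = yes refl

_≟_ : DecidableEquality Label
free      ≟ free      = yes refl
free      ≟ jump      = no λ ()
free      ≟ counter _ = no λ ()
jump      ≟ free      = no λ ()
jump      ≟ jump      = yes refl
jump      ≟ counter _ = no λ ()
counter _ ≟ free      = no λ ()
counter _ ≟ jump      = no λ ()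
counter c ≟ counter d = map′ (cong counter) (λ { refl → refl }) (c ≟ᶜ d)

delimits : Delimiter → Kind → Bool
delimits otherwise (delimiter otherwise) = true
delimits separator (delimiter separator) = true
delimits _    _                = false

-- `skip₀` has yet to meet the mark; `skip₁` has removed it and is looking for the delimiter. `put`
-- acts on the following cell, so the mark lands just behind the delimiter.
scanMark : MarkState → Tag → MarkState × Tag
scanMark fetch     (κ , true)  = got κ , κ , true
scanMark step₀     (κ , true)  = put false , κ , false
scanMark (skip₀ d) (κ , true)  = (if delimits d κ then put true else skip₁ d) , κ , false
scanMark (skip₁ d) (κ , b)     = (if delimits d κ then put true else skip₁ d) , κ , b
scanMark (put b)   (κ , _)     = done b , κ , true
scanMark reset₀    (κ , _)     = reset₁ , κ , true
scanMark reset₁    (κ , _)     = reset₁ , κ , false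
scanMark m         t           = m , t

initialLabel : Kind → Label
initialLabel pad = counter spare
initialLabel _   = free

scanU : UState → TaggedCell → UState × TaggedCell
scanU (mark m)       (t , ℓ)         = mark (proj₁ (scanMark m t)) , proj₂ (scanMark m t) , ℓ
scanU (relabel i j)  (t , ℓ)         = if does (ℓ ≟ i) then (relabelled i , t , j) else (relabel i j , t , ℓ)
scanU (relabelled i) c               = relabelled i , c
scanU (norm₀ b)      ((κ , _) , _)   = norm₁ b , (κ , true) , initialLabel κ
scanU (norm₁ b)      ((end , _) , _) = norm₂ b , (end , false) , free
scanU (norm₁ b)      ((κ , _) , _)   = norm₁ b , (κ , false) , initialLabel κ
scanU (norm₂ b)      _               = norm₂ b , (vacant , false) , free

-- A failed relabelling has three meanings: no `free` cell left is death for lack of space, no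
-- counter cell is a successful zero test and leads to `otherwise`, no `jump` cell ends a jump. A
-- jump is in unary: the text labels as many cells `jump` as there are texts to skip, a delimiter
-- sends the mark to the first cell, and then each `jump` cell set free moves the mark past one
-- separator.
turnU : UState → Maybe UState
turnU (mark (got (op i j)))      = just (relabel i j)
turnU (mark (got (delimiter _))) = just (mark reset₀)
turnU (mark (got stop))          = just (norm₀ false)
turnU (mark (done false))        = just (mark fetch)
turnU (mark (done true))         = just (relabel jump free)
turnU (mark reset₁)              = just (relabel jump free)
turnU (relabel jump _)           = just (mark fetch)
turnU (relabel (counter _) _)    = just (mark (skip₀ otherwise))
turnU (relabelled jump)          = just (mark (skip₀ separator))
turnU (relabelled _)             = just (mark step₀)
turnU (norm₂ false)              = just (norm₀ true)
turnU (norm₂ true)               = just (mark fetch)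
turnU _                          = nothing

universal : SweepMachine
universal = record
  { State = UState ; Cell = TaggedCell ; scan = scanU ; turn = turnU
  ; finiteState = finiteUState ; finiteCell = finite× (finite× finiteKind finiteBool) finiteLabel }

open SweepMachine universal using (sweep; finalState; rewritten)
open Segment universal using (afterHead; start; evolve; Doomed; sweep-back; sweep-dead; evolve-doomed)
open Automaton universal
  using (k; encode; automaton; startWord; Vanishes; Persists; Diagonal; doomed⇒vanishes; recurrent⇒persists; diagonalisation)

-- Tags and label tallies under a sweep

tags : List TaggedCell → List Tag
tags = map proj₁

labels : List TaggedCell → List Label
labels = map proj₂

[_is_] : Label → Label → ℕ
[ ℓ is i ] = if does (ℓ ≟ i) then 1 else 0

occurrences : Label → List Label → ℕ
occurrences i []       = 0
occurrences i (ℓ ∷ ls) = [ ℓ is i ] + occurrences i ls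

Valuation : Set
Valuation = Label → ℕ

-- v′ is v with one unit moved from i to j; both sides are arranged so that no
-- subtraction occurs.
Moved : Label → Label → Valuation → Valuation → Set
Moved i j v v′ = ∀ ℓ → [ i is ℓ ] + v′ ℓ ≡ [ j is ℓ ] + v ℓ

sweepMark : MarkState → List Tag → MarkState × List Tag
sweepMark m []       = m , []
sweepMark m (t ∷ ts) with sweepMark (proj₁ (scanMark m t)) ts
... | m′ , ts′ = m′ , proj₂ (scanMark m t) ∷ ts′

sweep-mark : ∀ m w → finalState (mark m) w ≡ mark (proj₁ (sweepMark m (tags w))) ×
                     tags (rewritten (mark m) w) ≡ proj₂ (sweepMark m (tags w)) ×
                     labels (rewritten (mark m) w) ≡ labels w
sweep-mark m []            = refl , refl , refl
sweep-mark m ((t , ℓ) ∷ w) with sweep-mark (proj₁ (scanMark m t)) w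
... | f , ts , ls = f , cong (proj₂ (scanMark m t) ∷_) ts , cong (ℓ ∷_) ls

sweep-relabelled : ∀ i w → sweep (relabelled i) w ≡ (relabelled i , w)
sweep-relabelled i []      = refl
sweep-relabelled i (c ∷ w) rewrite sweep-relabelled i w = refl

sweep-relabel : ∀ i j w {n} → occurrences i (labels w) ≡ suc n →
                finalState (relabel i j) w ≡ relabelled i × tags (rewritten (relabel i j) w) ≡ tags w ×
                Moved i j (λ ℓ → occurrences ℓ (labels w)) (λ ℓ → occurrences ℓ (labels (rewritten (relabel i j) w)))
sweep-relabel i j ((t , ℓ) ∷ w) occ with ℓ ≟ i
... | yes refl rewrite sweep-relabelled i w = refl , refl , λ x → x∙yz≈y∙xz [ i is x ] [ j is x ] (occurrences x (labels w))
... | no _ with sweep-relabel i j w occ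
...   | f , ts , moved = f , cong (t ∷_) ts , λ x → trans (x∙yz≈y∙xz [ i is x ] [ ℓ is x ] _)
          (trans (cong (λ n → [ ℓ is x ] + n) (moved x)) (x∙yz≈y∙xz [ ℓ is x ] [ j is x ] _))

sweep-relabel-none : ∀ i j w → occurrences i (labels w) ≡ 0 →
                     sweep (relabel i j) w ≡ (relabel i j , w)
sweep-relabel-none i j []            occ = refl
sweep-relabel-none i j ((t , ℓ) ∷ w) occ with ℓ ≟ i
... | no _ rewrite sweep-relabel-none i j w occ = refl

unmarked : List Kind → List Tag
unmarked = map (_, false)

marked : List Kind → List Kind → List Tag
marked before []          = unmarked before
marked before (κ ∷ after) = unmarked before ++ (κ , true) ∷ unmarked after

-- Runs are followed backwards, through a property Φ of machine states that is
-- inherited by predecessors: that the machine dies, or that it returns to its start.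
module _ (Φ : UState → List TaggedCell → Set) where

  -- The positions of the labels are left open: a relabelling takes whichever suitable cell comes
  -- first, so only the tallies can be predicted.
  record Always (q : UState) (ks ls : List Kind) (v : Valuation) : Set where
    constructor always
    field
      holds : ∀ w → tags w ≡ marked ks ls → (∀ ℓ → occurrences ℓ (labels w) ≡ v ℓ) → Φ q w

  open Always public

  DeadHolds : Set
  DeadHolds = ∀ q w → turnU (finalState q w) ≡ nothing → Φ q w

  module _ (back : ∀ {q w q′} → turnU (finalState q w) ≡ just q′ → Φ q′ (rewritten q w) → Φ q w) where

    always-mark : ∀ {m m′ q ks ls ks′ ls′ v} → sweepMark m (marked ks ls) ≡ (m′ , marked ks′ ls′) →
                  turnU (mark m′) ≡ just q → Always q ks′ ls′ v → Always (mark m) ks ls v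
    always-mark {m} eq tq cont .holds w ts occ with sweep-mark m w
    ... | f , ts′ , ls′ = back (trans (cong turnU (trans f (cong (mark ∘ proj₁) eq′))) tq)
      (cont .holds _ (trans ts′ (cong proj₂ eq′)) λ ℓ → trans (cong (occurrences ℓ) ls′) (occ ℓ))
      where eq′ = trans (cong (sweepMark m) ts) eq

    always-relabel : ∀ {i j n q ks ls v v′} → v i ≡ suc n → Moved i j v v′ → turnU (relabelled i) ≡ just q →
                     Always q ks ls v′ → Always (relabel i j) ks ls v
    always-relabel {i} {j} vi moved tq cont .holds w ts occ with sweep-relabel i j w (trans (occ i) vi)
    ... | f , ts′ , moved′ = back (trans (cong turnU f) tq) (cont .holds _ (trans ts′ ts) λ ℓ →
      ℕ.+-cancelˡ-≡ [ i is ℓ ] _ _ (trans (moved′ ℓ) (trans (cong (λ n → [ j is ℓ ] + n) (occ ℓ)) (sym (moved ℓ)))))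

    always-relabel-none : ∀ {i j q ks ls v} → v i ≡ 0 → turnU (relabel i j) ≡ just q →
                          Always q ks ls v → Always (relabel i j) ks ls v
    always-relabel-none {i} {j} vi tq cont .holds w ts occ with sweep-relabel-none i j w (trans (occ i) vi)
    ... | eq = back (trans (cong (turnU ∘ proj₁) eq) tq) (subst (Φ _) (sym (cong proj₂ eq)) (cont .holds w ts occ))

    always-relabel-dead : ∀ {j ks ls v} → DeadHolds → v free ≡ 0 → Always (relabel free j) ks ls v
    always-relabel-dead {j} dead vf .holds w ts occ =
      dead _ w (cong (turnU ∘ proj₁) (sweep-relabel-none free j w (trans (occ free) vf)))

-- Programs of the universal machine

data Instruction (S : Set) : Set where
  inc      : Counter → S → Instruction S
  transfer : Counter → Counter → S → S → Instruction S
  stop die : Instruction S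

jumps : ℕ → List Kind
jumps n = replicate n (op free jump)

-- Each text has exactly one `separator`, at its end, so skipping a separators from the first cell
-- leads to the text at position a. A delimiter that is executed means that all jumps are written
-- and the jump is to be made; `otherwise` moreover is where a failed transfer resumes.
text : ∀ {S} → (S → ℕ) → Instruction S → List Kind
text address (inc c s)           = op free (counter c) ∷ jumps (address s) ++ delimiter separator ∷ []
text address (transfer i j s s′) = op (counter i) (counter j) ∷ jumps (address s) ++
                               delimiter otherwise ∷ jumps (address s′) ++ delimiter separator ∷ []
text address stop = stop ∷ delimiter separator ∷ []
text address die  = die ∷ delimiter separator ∷ []

Nonempty : ∀ {A : Set} → List A → Set
Nonempty xs = ∃₂ λ x ys → xs ≡ x ∷ ys

nonempty-++ : ∀ {A : Set} xs {ys : List A} → Nonempty ys → Nonempty (xs ++ ys)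
nonempty-++ []       ne = ne
nonempty-++ (x ∷ xs) ne = x , _ , refl

Without : Delimiter → List Kind → Set
Without d = All (λ κ → delimits d κ ≡ false)

jumps-without : ∀ d n → Without d (jumps n)
jumps-without otherwise n = All.replicate⁺ n refl
jumps-without separator n = All.replicate⁺ n refl

Terminated : List Kind → Set
Terminated ks = ∃ λ body → ks ≡ body ++ delimiter separator ∷ [] × Without separator body

text-terminated : ∀ {S} address (i : Instruction S) → Terminated (text address i)
text-terminated address (inc c s) =
  op free (counter c) ∷ jumps (address s) , refl , refl ∷ jumps-without separator (address s)
text-terminated address (transfer i j s s′) =
  op (counter i) (counter j) ∷ jumps (address s) ++ delimiter otherwise ∷ jumps (address s′) ,
  cong (op (counter i) (counter j) ∷_) (sym (++-assoc (jumps (address s)) _ _)) ,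
  refl ∷ All.++⁺ (jumps-without separator (address s)) (refl ∷ jumps-without separator (address s′))
text-terminated address stop = stop ∷ [] , refl , refl ∷ []
text-terminated address die  = die ∷ [] , refl , refl ∷ []

sweepMark-idle : ∀ {m} → (∀ κ → scanMark m (κ , false) ≡ (m , κ , false)) → ∀ ks ts →
                 sweepMark m (unmarked ks ++ ts) ≡ (proj₁ (sweepMark m ts) , unmarked ks ++ proj₂ (sweepMark m ts))
sweepMark-idle idle []       ts = refl
sweepMark-idle idle (κ ∷ ks) ts rewrite idle κ | sweepMark-idle idle ks ts = refl

sweepMark-fixed : ∀ {m} → (∀ t → scanMark m t ≡ (m , t)) → ∀ ts → sweepMark m ts ≡ (m , ts)
sweepMark-fixed fixed []       = refl
sweepMark-fixed fixed (t ∷ ts) rewrite fixed t | sweepMark-fixed fixed ts = refl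

sweepMark-fetch : ∀ ks κ ls → sweepMark fetch (marked ks (κ ∷ ls)) ≡ (got κ , marked ks (κ ∷ ls))
sweepMark-fetch ks κ ls rewrite sweepMark-idle {fetch} (λ _ → refl) ks ((κ , true) ∷ unmarked ls)
                              | sweepMark-fixed {got κ} (λ _ → refl) (unmarked ls) = refl

marked-++ : ∀ ks ls {κ ms} → unmarked ks ++ unmarked ls ++ (κ , true) ∷ unmarked ms ≡ marked (ks ++ ls) (κ ∷ ms)
marked-++ ks ls = trans (sym (++-assoc (unmarked ks) (unmarked ls) _)) (cong (_++ _) (sym (map-++ (_, false) ks ls)))

sweepMark-step : ∀ ks κ {ls} → Nonempty ls → sweepMark step₀ (marked ks (κ ∷ ls)) ≡ (done false , marked (ks ++ κ ∷ []) ls)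
sweepMark-step ks κ (κ′ , ls , refl)
  rewrite sweepMark-idle {step₀} (λ _ → refl) ks ((κ , true) ∷ unmarked (κ′ ∷ ls))
        | sweepMark-fixed {done false} (λ _ → refl) (unmarked ls) = cong (done false ,_) (marked-++ ks (κ ∷ []))

delimits-refl : ∀ d → delimits d (delimiter d) ≡ true
delimits-refl otherwise = refl
delimits-refl separator = refl

sweepMark-skip₁ : ∀ d {body} → Without d body → ∀ κ ls →
  sweepMark (skip₁ d) (unmarked (body ++ delimiter d ∷ κ ∷ ls)) ≡
  (done true , unmarked body ++ (delimiter d , false) ∷ (κ , true) ∷ unmarked ls)
sweepMark-skip₁ d [] κ ls rewrite delimits-refl d | sweepMark-fixed {done true} (λ _ → refl) (unmarked ls) = refl
sweepMark-skip₁ d (eq ∷ w) κ ls rewrite eq | sweepMark-skip₁ d w κ ls = refl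

sweepMark-skip : ∀ ks d {body ls} → Without d body → Nonempty ls →
  sweepMark (skip₀ d) (marked ks (body ++ delimiter d ∷ ls)) ≡ (done true , marked (ks ++ body ++ delimiter d ∷ []) ls)
sweepMark-skip ks d [] (κ , ls , refl)
  rewrite sweepMark-idle {skip₀ d} (λ _ → refl) ks ((delimiter d , true) ∷ (κ , false) ∷ unmarked ls)
        | delimits-refl d | sweepMark-fixed {done true} (λ _ → refl) (unmarked ls) =
  cong (done true ,_) (marked-++ ks (delimiter d ∷ []))
sweepMark-skip ks d {b ∷ body} (eq ∷ w) (κ , ls , refl)
  rewrite sweepMark-idle {skip₀ d} (λ _ → refl) ks ((b , true) ∷ unmarked (body ++ delimiter d ∷ κ ∷ ls))
        | eq | sweepMark-skip₁ d w κ ls =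
  cong (done true ,_) (trans (cong (λ ts → unmarked ks ++ (b , false) ∷ ts)
      (trans (sym (++-assoc (unmarked body) _ _)) (cong (_++ _) (sym (map-++ (_, false) body (delimiter d ∷ []))))))
    (marked-++ ks (b ∷ body ++ delimiter d ∷ [])))

sweepMark-reset₁ : ∀ ts → sweepMark reset₁ ts ≡ (reset₁ , unmarked (map proj₁ ts))
sweepMark-reset₁ []       = refl
sweepMark-reset₁ (t ∷ ts) rewrite sweepMark-reset₁ ts = refl

kinds-unmarked : ∀ ks → map proj₁ (unmarked ks) ≡ ks
kinds-unmarked []       = refl
kinds-unmarked (κ ∷ ks) = cong (κ ∷_) (kinds-unmarked ks)

kinds-marked : ∀ ks κ ls → map proj₁ (marked ks (κ ∷ ls)) ≡ ks ++ κ ∷ ls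
kinds-marked ks κ ls = trans (map-++ proj₁ (unmarked ks) _)
  (cong₂ (λ xs ys → xs ++ κ ∷ ys) (kinds-unmarked ks) (kinds-unmarked ls))

sweepMark-reset : ∀ ks κ ls → sweepMark reset₀ (marked ks (κ ∷ ls)) ≡ (reset₁ , marked [] (ks ++ κ ∷ ls))
sweepMark-reset []       κ ls rewrite sweepMark-reset₁ (unmarked ls) | kinds-unmarked ls = refl
sweepMark-reset (k ∷ ks) κ ls rewrite sweepMark-reset₁ (marked ks (κ ∷ ls)) | kinds-marked ks κ ls = refl

Counts : Set
Counts = Counter → ℕ

valuation : ℕ → ℕ → Counts → Valuation
valuation f z c free        = f
valuation f z c jump        = z
valuation f z c (counter i) = c i

moved-jump : ∀ f z c → Moved free jump (valuation (suc f) z c) (valuation f (suc z) c)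
moved-jump f z c free        = refl
moved-jump f z c jump        = refl
moved-jump f z c (counter i) = refl

moved-free : ∀ f z c → Moved jump free (valuation f (suc z) c) (valuation (suc f) z c)
moved-free f z c free        = refl
moved-free f z c jump        = refl
moved-free f z c (counter i) = refl

Incremented : Counter → Counts → Counts → Set
Incremented j c c′ = ∀ x → c′ x ≡ [ counter j is counter x ] + c x

Transferred : Counter → Counter → Counts → Counts → Set
Transferred i j c c′ = ∀ x → [ counter i is counter x ] + c′ x ≡ [ counter j is counter x ] + c x

moved-inc : ∀ {j c c′} f z → Incremented j c c′ → Moved free (counter j) (valuation (suc f) z c) (valuation f z c′)
moved-inc f z eq free        = refl
moved-inc f z eq jump        = refl
moved-inc f z eq (counter i) = eq i

moved-transfer : ∀ {i j c c′} f z → Transferred i j c c′ →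
                 Moved (counter i) (counter j) (valuation f z c) (valuation f z c′)
moved-transfer f z eq free        = refl
moved-transfer f z eq jump        = refl
moved-transfer f z eq (counter i) = eq i

concat-take-drop : ∀ {A : Set} n (xss : List (List A)) → concat (take n xss) ++ concat (drop n xss) ≡ concat xss
concat-take-drop n xss = trans (concat-++ (take n xss) (drop n xss)) (cong concat (take++drop≡id n xss))

drop-tabulate : ∀ {A : Set} {n} (f : Fin n → A) i →
                drop (toℕ i) (tabulate f) ≡ f i ∷ drop (suc (toℕ i)) (tabulate f)
drop-tabulate f Fin.zero    = refl
drop-tabulate f (Fin.suc i) = drop-tabulate (f ∘ Fin.suc) i

record Program : Set₁ where
  field
    Location    : Set
    locations   : Finite Location
    entry       : Location
    instruction : Location → Instruction Location

  -- Shifted by one because position 0 holds an extra copy of the entry's text: execution begins at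
  -- the first cell, whatever the index of the entry.
  address : Location → ℕ
  address s = suc (toℕ (index locations s))

  texts : List (List Kind)
  texts = text address (instruction entry) ∷ tabulate (λ i → text address (instruction (element locations i)))

  TextAt : Location → ℕ → Set
  TextAt s a = drop a texts ≡ text address (instruction s) ∷ drop (suc a) texts

  textAt-address : ∀ s → TextAt s (address s)
  textAt-address s = trans (drop-tabulate _ (index locations s))
    (cong (λ s′ → text address (instruction s′) ∷ drop (suc (address s)) texts) (element-index locations s))

  length-take-texts : ∀ s → length (take (address s) texts) ≡ address s
  length-take-texts s = trans (length-take (address s) texts) (ℕ.m≤n⇒m⊓n≡m
    (s≤s (ℕ.≤-trans (ℕ.<⇒≤ (Fin.toℕ<n (index locations s))) (ℕ.≤-reflexive (sym (length-tabulate _))))))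

  texts-terminated : All Terminated texts
  texts-terminated = text-terminated address (instruction entry) ∷
    All.tabulate⁺ λ i → text-terminated address (instruction (element locations i))

  module Execution (Φ : UState → List TaggedCell → Set)
    (back : ∀ {q w q′} → turnU (SweepMachine.finalState universal q w) ≡ just q′ →
            Φ q′ (SweepMachine.rewritten universal q w) → Φ q w)
    (tail : List Kind) (tail-nonempty : Nonempty tail) where

    At : UState → List Kind → List Kind → Valuation → Set
    At = Always Φ

    -- The machine dies when it runs out of free cells.  This does no harm if Φ
    -- holds wherever it dies, and cannot happen if there are enough of them.
    Enough : ℕ → ℕ → Set
    Enough n f = DeadHolds Φ ⊎ n ≤ f

    whole : List Kind
    whole = concat texts ++ tail

    AtAddress : ℕ → ℕ → Counts → Set
    AtAddress a f c = At (mark fetch) (concat (take a texts)) (concat (drop a texts) ++ tail) (valuation f 0 c)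

    always-fetch : ∀ {ks κ ls v q} → turnU (mark (got κ)) ≡ just q → At q ks (κ ∷ ls) v →
                   At (mark fetch) ks (κ ∷ ls) v
    always-fetch {ks} {κ} {ls} tq at =
      always-mark Φ back {ks = ks} {κ ∷ ls} {ks} {κ ∷ ls} (sweepMark-fetch ks κ ls) tq at

    step-op : ∀ {i j n ks ls v v′} → v i ≡ suc n → Moved i j v v′ → turnU (relabelled i) ≡ just (mark step₀) →
              Nonempty ls → At (mark fetch) (ks ++ op i j ∷ []) ls v′ → At (mark fetch) ks (op i j ∷ ls) v
    step-op {i} {j} {ks = ks} {ls} vi moved tq ne at =
      always-fetch refl
        (always-relabel Φ back vi moved tq
          (always-mark Φ back (sweepMark-step ks (op i j) ne) refl at))

    fail-op : ∀ {i j ks body ls v} → v (counter i) ≡ 0 → Without otherwise body → Nonempty ls →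
              At (relabel jump free) (ks ++ (op (counter i) (counter j) ∷ body) ++ delimiter otherwise ∷ []) ls v →
              At (mark fetch) ks (op (counter i) (counter j) ∷ body ++ delimiter otherwise ∷ ls) v
    fail-op {i} {j} {ks} {body} {ls} vi w ne at =
      always-fetch refl
        (always-relabel-none Φ back vi refl
          (always-mark Φ back (sweepMark-skip ks otherwise (refl ∷ w) ne) refl at))

    -- Each round frees one `jump` cell and passes one text, so the tally of `jump` is always the
    -- number of texts still ahead.
    jump-loop : ∀ ts {ks ls f c} → All Terminated ts → Nonempty ls →
                At (mark fetch) (ks ++ concat ts) ls (valuation (length ts + f) 0 c) →
                At (relabel jump free) ks (concat ts ++ ls) (valuation f (length ts) c)
    jump-loop [] {ks} {ls} {f} {c} [] ne at = always-relabel-none Φ back refl refl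
      (subst (λ ks → At (mark fetch) ks ls (valuation f 0 c)) (++-identityʳ ks) at)
    jump-loop (t ∷ ts) {ks} {ls} {f} {c} ((body , refl , w) ∷ ws) ne at =
      always-relabel Φ back refl (moved-free f (length ts) c) refl
        (subst (λ xs → At (mark (skip₀ separator)) ks xs (valuation (suc f) (length ts) c)) reassociate
          (always-mark Φ back (sweepMark-skip ks separator w (nonempty-++ (concat ts) ne)) refl
            (jump-loop ts ws ne
              (subst₂ (λ ks f → At (mark fetch) ks ls (valuation f 0 c))
                (sym (++-assoc ks t (concat ts))) (sym (ℕ.+-suc (length ts) f)) at))))
      where
      reassociate : body ++ delimiter separator ∷ concat ts ++ ls ≡ concat (t ∷ ts) ++ ls
      reassociate = trans (sym (++-assoc body (delimiter separator ∷ []) (concat ts ++ ls))) (sym (++-assoc t (concat ts) ls))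

    write-jumps : ∀ n {m f z c ks ls} → Enough (n + m) f → Nonempty ls →
                  (∀ f′ → Enough m f′ → At (mark fetch) (ks ++ jumps n) ls (valuation f′ (n + z) c)) →
                  At (mark fetch) ks (jumps n ++ ls) (valuation f z c)
    write-jumps zero {f = f} {z} {c} {ks} {ls} en ne at =
      subst (λ ks → At (mark fetch) ks ls (valuation f z c)) (++-identityʳ ks) (at f en)
    write-jumps (suc n) {f = zero} {ks = ks} {ls} (inj₁ dead) ne at =
      always-fetch refl (always-relabel-dead Φ back dead refl)
    write-jumps (suc n) {m} {suc f} {z} {c} {ks} {ls} en ne at =
      step-op refl (moved-jump f z c) refl (nonempty-++ (jumps n) ne)
        (write-jumps n (Sum.map₂ s≤s⁻¹ en) ne λ f′ en′ →
          subst₂ (λ ks z → At (mark fetch) ks ls (valuation f′ z c))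
            (sym (++-assoc ks (op free jump ∷ []) (jumps n))) (sym (ℕ.+-suc n z)) (at f′ en′))

    -- The cells lent to the jump are free again on arrival, yet the budget treats them as spent.
    -- This crude bound is enough, as only finitely many jumps occur in a halting run, and it makes
    -- the bounds simply add up.
    goto : ∀ s {d m f c ks ls} → ks ++ jumps (address s) ++ delimiter d ∷ ls ≡ whole → Enough (address s + m) f →
           (∀ f′ → Enough m f′ → AtAddress (address s) f′ c) →
           At (mark fetch) ks (jumps (address s) ++ delimiter d ∷ ls) (valuation f 0 c)
    goto s {d} {m} {f} {c} {ks} {ls} eq en at = write-jumps a en (_ , _ , refl) λ f′ en′ →
      always-fetch refl
        (always-mark Φ back (sweepMark-reset (ks ++ jumps a) (delimiter d) ls) refl
          (subst₂ (λ ks z → At (relabel jump free) [] ks (valuation f′ z c))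
            (sym (trans (++-assoc ks (jumps a) (delimiter d ∷ ls)) (trans eq split)))
            (trans (length-take-texts s) (sym (ℕ.+-identityʳ a)))
            (jump-loop (take a texts) (All.take⁺ a texts-terminated)
              (nonempty-++ (concat (drop a texts)) tail-nonempty)
              (at (length (take a texts) + f′) (Sum.map₂ (λ le → ℕ.≤-trans le (ℕ.m≤n+m f′ _)) en′)))))
      where
      a = address s
      split : whole ≡ concat (take a texts) ++ concat (drop a texts) ++ tail
      split = trans (cong (_++ tail) (sym (concat-take-drop a texts))) (++-assoc (concat (take a texts)) _ tail)

    module _ {s : Location} {a : ℕ} (text-at : TextAt s a) where
      private
        ks ls : List Kind
        ks = concat (take a texts)
        ls = concat (drop (suc a) texts) ++ tail

      at-address : ∀ {i f c} → instruction s ≡ i →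
                   (ks ++ text address i ++ ls ≡ whole → At (mark fetch) ks (text address i ++ ls) (valuation f 0 c)) →
                   AtAddress a f c
      at-address {f = f} {c} refl at = subst (λ xs → At (mark fetch) ks xs (valuation f 0 c)) here
        (at (trans (cong (ks ++_) here) (trans (sym (++-assoc ks _ tail)) (cong (_++ tail) (concat-take-drop a texts)))))
        where
        here : text address (instruction s) ++ ls ≡ concat (drop a texts) ++ tail
        here = trans (sym (++-assoc (text address (instruction s)) _ tail))
          (cong (λ ts → concat ts ++ tail) (sym text-at))

      at-inc : ∀ {j s′ m f c c′} → instruction s ≡ inc j s′ → Incremented j c c′ → Enough (suc (address s′ + m)) f →
               (∀ f → Enough m f → AtAddress (address s′) f c′) → AtAddress a f c
      at-inc {j} {s′} {m} {f}  {c} {c′} eq incr en at = at-address eq λ w →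
        subst (λ xs → At (mark fetch) ks (op free (counter j) ∷ xs) (valuation f 0 c)) (sym reassociate)
          (bump f en (trans (++-assoc ks _ _) (trans (cong (λ xs → ks ++ op free (counter j) ∷ xs) (sym reassociate)) w)))
        where
        reassociate : (jumps (address s′) ++ delimiter separator ∷ []) ++ ls ≡ jumps (address s′) ++ delimiter separator ∷ ls
        reassociate = ++-assoc (jumps (address s′)) _ ls
        bump : ∀ f → Enough (suc (address s′ + m)) f → (ks ++ op free (counter j) ∷ []) ++ jumps (address s′) ++ delimiter separator ∷ ls ≡ whole →
               At (mark fetch) ks (op free (counter j) ∷ jumps (address s′) ++ delimiter separator ∷ ls) (valuation f 0 c)
        bump zero (inj₁ dead) w = always-fetch refl (always-relabel-dead Φ back dead refl)
        bump (suc f) en w = step-op refl (moved-inc f 0 incr) refl (nonempty-++ (jumps (address s′)) (_ , _ , refl))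
          (goto s′ w (Sum.map₂ s≤s⁻¹ en) at)

      private
        reassociate-transfer : ∀ s₁ s₂ → (jumps (address s₁) ++ delimiter otherwise ∷ jumps (address s₂) ++ delimiter separator ∷ []) ++ ls ≡
                           jumps (address s₁) ++ delimiter otherwise ∷ jumps (address s₂) ++ delimiter separator ∷ ls
        reassociate-transfer s₁ s₂ = trans (++-assoc (jumps (address s₁)) _ ls)
          (cong (λ xs → jumps (address s₁) ++ delimiter otherwise ∷ xs) (++-assoc (jumps (address s₂)) _ ls))

      at-transfer : ∀ {i j s₁ s₂ n m f c c′} → instruction s ≡ transfer i j s₁ s₂ → c i ≡ suc n → Transferred i j c c′ →
                Enough (address s₁ + m) f → (∀ f → Enough m f → AtAddress (address s₁) f c′) → AtAddress a f c
      at-transfer {i} {j} {s₁} {s₂} {f = f} {c} eq ci tr en at = at-address eq λ w →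
        subst (λ xs → At (mark fetch) ks (op (counter i) (counter j) ∷ xs) (valuation f 0 c)) (sym (reassociate-transfer s₁ s₂))
          (step-op ci (moved-transfer f 0 tr) refl (nonempty-++ (jumps (address s₁)) (_ , _ , refl))
            (goto s₁ (trans (++-assoc ks _ _)
              (trans (cong (λ xs → ks ++ op (counter i) (counter j) ∷ xs) (sym (reassociate-transfer s₁ s₂))) w)) en at))

      at-transfer-fail : ∀ {i j s₁ s₂ m f c} → instruction s ≡ transfer i j s₁ s₂ → c i ≡ 0 →
                     Enough (address s₂ + m) f → (∀ f → Enough m f → AtAddress (address s₂) f c) → AtAddress a f c
      at-transfer-fail {i} {j} {s₁} {s₂} {f = f} {c} eq ci en at = at-address eq λ w →
        subst (λ xs → At (mark fetch) ks (op (counter i) (counter j) ∷ xs) (valuation f 0 c)) (sym (reassociate-transfer s₁ s₂))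
          (fail-op ci (jumps-without otherwise (address s₁)) (nonempty-++ (jumps (address s₂)) (_ , _ , refl))
            -- Passing a delimiter always leads into the jump loop; here it ends at once, since no
            -- cell is labelled `jump`.
            (always-relabel-none Φ back refl refl
              (goto s₂ (trans (++-assoc ks _ _) (trans (cong (ks ++_) (trans
                  (cong (op (counter i) (counter j) ∷_) (++-assoc (jumps (address s₁)) _ _))
                  (cong (op (counter i) (counter j) ∷_) (sym (reassociate-transfer s₁ s₂))))) w)) en at)))

      at-stop : ∀ {f c} → instruction s ≡ stop → (∀ w → map proj₁ (tags w) ≡ whole → Φ (norm₀ false) w) →
                AtAddress a f c
      at-stop eq at = at-address eq λ whole≡ → always-fetch refl
        (always λ w ts _ → at w (trans (cong (map proj₁) ts) (trans (kinds-marked ks stop _) whole≡)))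

      at-die : ∀ {f c} → instruction s ≡ die → DeadHolds Φ → AtAddress a f c
      at-die eq dead = at-address eq λ _ → always λ w ts _ → dead _ w
        (cong turnU (trans (proj₁ (sweep-mark fetch w))
          (cong mark (trans (cong (proj₁ ∘ sweepMark fetch) ts) (cong proj₁ (sweepMark-fetch ks die _))))))

-- Normalisation of the tape

initialCell : Kind → TaggedCell
initialCell κ = (κ , false) , initialLabel κ

initialCells : List Kind → List TaggedCell
initialCells []       = []
initialCells (κ ∷ ks) = ((κ , true) , initialLabel κ) ∷ map initialCell ks

initialCells-++ : ∀ {ks} → Nonempty ks → ∀ ls → initialCells (ks ++ ls) ≡ initialCells ks ++ map initialCell ls
initialCells-++ (κ , ks , refl) ls = cong (_ ∷_) (map-++ initialCell ks ls)

kindsOf : List TaggedCell → List Kind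
kindsOf w = map proj₁ (tags w)

kindsOf-map : ∀ ks → kindsOf (map initialCell ks) ≡ ks
kindsOf-map []       = refl
kindsOf-map (κ ∷ ks) = cong (κ ∷_) (kindsOf-map ks)

kindsOf-initial : ∀ ks → kindsOf (initialCells ks) ≡ ks
kindsOf-initial []       = refl
kindsOf-initial (κ ∷ ks) = cong (κ ∷_) (kindsOf-map ks)

tags-map : ∀ ks → tags (map initialCell ks) ≡ unmarked ks
tags-map []       = refl
tags-map (κ ∷ ks) = cong (_ ∷_) (tags-map ks)

tags-initial : ∀ ks → tags (initialCells ks) ≡ marked [] ks
tags-initial []       = refl
tags-initial (κ ∷ ks) = cong (_ ∷_) (tags-map ks)

labels-map : ∀ ks → labels (map initialCell ks) ≡ map initialLabel ks
labels-map []       = refl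
labels-map (κ ∷ ks) = cong (_ ∷_) (labels-map ks)

labels-initial : ∀ ks → labels (initialCells ks) ≡ map initialLabel ks
labels-initial []       = refl
labels-initial (κ ∷ ks) = cong (_ ∷_) (labels-map ks)

sweep-norm₂ : ∀ b w ks → kindsOf w ≡ ks → sweep (norm₂ b) w ≡ (norm₂ b , map initialCell (replicate (length ks) vacant))
sweep-norm₂ b []      []       eq = refl
sweep-norm₂ b (c ∷ w) (κ ∷ ks) eq rewrite sweep-norm₂ b w (kindsOf w) refl =
  cong (λ n → norm₂ b , map initialCell (vacant ∷ replicate n vacant))
    (ℕ.suc-injective (cong length eq))

scan-norm₁ : ∀ b κ {x ℓ} → κ ≢ end → scanU (norm₁ b) ((κ , x) , ℓ) ≡ (norm₁ b , initialCell κ)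
scan-norm₁ b (op _ _)      ne = refl
scan-norm₁ b (delimiter _) ne = refl
scan-norm₁ b stop          ne = refl
scan-norm₁ b die           ne = refl
scan-norm₁ b pad           ne = refl
scan-norm₁ b end           ne = contradiction refl ne
scan-norm₁ b vacant        ne = refl

sweep-norm₁ : ∀ b w ks ls → All (_≢ end) ks → kindsOf w ≡ ks ++ end ∷ ls →
              sweep (norm₁ b) w ≡ (norm₂ b , map initialCell (ks ++ end ∷ replicate (length ls) vacant))
sweep-norm₁ b (((end , _) , _) ∷ w) [] ls [] refl rewrite sweep-norm₂ b w (kindsOf w) refl = refl
sweep-norm₁ b (((κ , x) , ℓ) ∷ w) (κ′ ∷ ks) ls (ne ∷ nes) eq with ∷-injective eq
... | refl , eq′ rewrite scan-norm₁ b κ {x} {ℓ} ne | sweep-norm₁ b w ks ls nes eq′ = refl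

sweep-norm₀ : ∀ b w κ ks ls → All (_≢ end) ks → kindsOf w ≡ κ ∷ ks ++ end ∷ ls →
              sweep (norm₀ b) w ≡ (norm₂ b , initialCells (κ ∷ ks ++ end ∷ replicate (length ls) vacant))
sweep-norm₀ b (((κ , x) , ℓ) ∷ w) κ′ ks ls nes eq with ∷-injective eq
... | refl , eq′ rewrite sweep-norm₁ b w ks ls nes eq′ = refl

data Code : Kind → Set where
  op        : ∀ i j → Code (op i j)
  delimiter : ∀ d → Code (delimiter d)
  stop      : Code stop
  die       : Code die

code≢end : ∀ {κ} → Code κ → κ ≢ end
code≢end () refl

code-free : ∀ {κ} → Code κ → initialLabel κ ≡ free
code-free (op _ _)      = refl
code-free (delimiter _) = refl
code-free stop          = refl
code-free die           = refl

text-code : ∀ {S} address (i : Instruction S) → All Code (text address i)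
text-code address (inc c s) = op _ _ ∷ All.++⁺ (All.replicate⁺ (address s) (op _ _)) (delimiter _ ∷ [])
text-code address (transfer i j s s′) = op _ _ ∷ All.++⁺ (All.replicate⁺ (address s) (op _ _))
  (delimiter _ ∷ All.++⁺ (All.replicate⁺ (address s′) (op _ _)) (delimiter _ ∷ []))
text-code address stop = stop ∷ delimiter _ ∷ []
text-code address die  = die ∷ delimiter _ ∷ []

text-nonempty : ∀ {S} address (i : Instruction S) → Nonempty (text address i)
text-nonempty address (inc c s)       = _ , _ , refl
text-nonempty address (transfer i j s s′) = _ , _ , refl
text-nonempty address stop            = _ , _ , refl
text-nonempty address die             = _ , _ , refl

++-nonempty : ∀ {A : Set} {xs : List A} → Nonempty xs → ∀ ys → Nonempty (xs ++ ys)
++-nonempty (x , xs , refl) ys = x , xs ++ ys , refl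

occurrences-++ : ∀ i ls ms → occurrences i (ls ++ ms) ≡ occurrences i ls + occurrences i ms
occurrences-++ i []       ms = refl
occurrences-++ i (ℓ ∷ ls) ms = trans (cong (λ n → [ ℓ is i ] + n) (occurrences-++ i ls ms)) (sym (ℕ.+-assoc [ ℓ is i ] _ _))

occurrences-constant : ∀ i {ℓ ks} → All (λ κ → initialLabel κ ≡ ℓ) ks →
                       occurrences i (map initialLabel ks) ≡ length ks * [ ℓ is i ]
occurrences-constant i []         = refl
occurrences-constant i {ℓ} (refl ∷ a) = cong (λ x → [ ℓ is i ] + x) (occurrences-constant i a)

counts : ℕ × ℕ → ℕ → ℕ → Counts
counts (l , r) t n (stack left)  = l
counts (l , r) t n (stack right) = r
counts (l , r) t n temp          = t
counts (l , r) t n spare         = n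

initialCounts : ℕ → Counts
initialCounts n = counts (0 , 0) 0 n

-- From runs of a program to the fate of its start word

module _ (P : Program) where
  open Program P

  -- Inheritance by predecessors again, now at the level of locations and counts. Through this
  -- interface the simulation of a Turing machine is independent of cells, sweeps and space.
  record Closed (G : Location → Counts → Set) : Set where
    field
      closed-inc  : ∀ {s j s′ c c′} → instruction s ≡ inc j s′ → Incremented j c c′ → G s′ c′ → G s c
      closed-transfer : ∀ {s i j s₁ s₂ x c c′} → instruction s ≡ transfer i j s₁ s₂ → c i ≡ suc x →
                    Transferred i j c c′ → G s₁ c′ → G s c
      closed-fail : ∀ {s i j s₁ s₂ c} → instruction s ≡ transfer i j s₁ s₂ → c i ≡ 0 → G s₂ c → G s c

  module _ (n : ℕ) where

    padding : ℕ → List Kind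
    padding m = replicate n pad ++ end ∷ replicate m vacant

    kinds : ℕ → List Kind
    kinds m = concat texts ++ padding m

    startCells : List TaggedCell
    startCells = initialCells (concat texts ++ replicate n pad ++ end ∷ [])

    padding-nonempty : ∀ m → Nonempty (padding m)
    padding-nonempty m = nonempty-++ (replicate n pad) (_ , _ , refl)

    codes : All Code (concat texts)
    codes = All.concat⁺ (text-code address (instruction entry) ∷
      All.tabulate⁺ λ i → text-code address (instruction (element locations i)))

    texts-nonempty : Nonempty (concat texts)
    texts-nonempty = ++-nonempty (text-nonempty address (instruction entry)) _

    initialCells-kinds : ∀ m → initialCells (kinds m) ≡ startCells ++ map initialCell (replicate m vacant)
    initialCells-kinds m = trans
      (cong initialCells (trans (cong (concat texts ++_) (sym (++-assoc (replicate n pad) (end ∷ []) _)))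
        (sym (++-assoc (concat texts) (replicate n pad ++ end ∷ []) _))))
      (initialCells-++ (++-nonempty texts-nonempty _) (replicate m vacant))

    startCells-nonempty : Nonempty startCells
    startCells-nonempty with concat texts | texts-nonempty
    ... | _ | κ , ks , refl = _ , _ , refl

    initial-occurrences : ∀ m ℓ → occurrences ℓ (labels (initialCells (kinds m))) ≡
      length (concat texts) * [ free is ℓ ] + (n * [ counter spare is ℓ ] + suc m * [ free is ℓ ])
    initial-occurrences m ℓ = begin
      occurrences ℓ (labels (initialCells (kinds m))) ≡⟨ cong (occurrences ℓ) (labels-initial (kinds m)) ⟩
      occurrences ℓ (map initialLabel (kinds m))
        ≡⟨ cong (occurrences ℓ) (map-++ initialLabel (concat texts) (padding m)) ⟩
      occurrences ℓ (map initialLabel (concat texts) ++ map initialLabel (padding m))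
        ≡⟨ occurrences-++ ℓ (map initialLabel (concat texts)) _ ⟩
      occurrences ℓ (map initialLabel (concat texts)) + occurrences ℓ (map initialLabel (padding m))
        ≡⟨ cong₂ _+_ (occurrences-constant ℓ (All.map code-free codes)) paddingOccurrences ⟩
      _ ∎
      where
      open ≡-Reasoning
      paddingOccurrences : occurrences ℓ (map initialLabel (padding m)) ≡ n * [ counter spare is ℓ ] + suc m * [ free is ℓ ]
      paddingOccurrences = begin
        occurrences ℓ (map initialLabel (padding m))
          ≡⟨ cong (occurrences ℓ) (map-++ initialLabel (replicate n pad) _) ⟩
        occurrences ℓ (map initialLabel (replicate n pad) ++ map initialLabel (end ∷ replicate m vacant))
          ≡⟨ occurrences-++ ℓ (map initialLabel (replicate n pad)) _ ⟩
        _ ≡⟨ cong₂ _+_ (occurrences-constant ℓ {counter spare} (All.replicate⁺ n refl))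
                       (occurrences-constant ℓ {free} {end ∷ _} (refl ∷ All.replicate⁺ m refl)) ⟩
        length (replicate n pad) * [ counter spare is ℓ ] + suc (length (replicate m vacant)) * [ free is ℓ ]
          ≡⟨ cong₂ (λ x y → x * [ counter spare is ℓ ] + suc y * [ free is ℓ ]) (length-replicate n) (length-replicate m) ⟩
        _ ∎

    -- The cells of the program text and of `end` count as free along with the vacant ones, while
    -- the pads make up `spare`. The number of free cells is left unsimplified so that its own
    -- clause holds by `refl`.
    initial-valuation : ∀ m → ∃ λ f → m ≤ f ×
      (∀ ℓ → occurrences ℓ (labels (initialCells (kinds m))) ≡ valuation f 0 (initialCounts n) ℓ)
    initial-valuation m = L * 1 + (n * 0 + suc m * 1) ,
      ℕ.≤-trans (ℕ.n≤1+n m) (ℕ.≤-trans (ℕ.≤-reflexive (sym (ℕ.*-identityʳ (suc m))))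
        (ℕ.≤-trans (ℕ.m≤n+m (suc m * 1) (n * 0)) (ℕ.m≤n+m _ (L * 1)))) ,
      λ ℓ → trans (initial-occurrences m ℓ) (value ℓ)
      where
      L = length (concat texts)
      value : ∀ ℓ → L * [ free is ℓ ] + (n * [ counter spare is ℓ ] + suc m * [ free is ℓ ]) ≡
                    valuation (L * 1 + (n * 0 + suc m * 1)) 0 (initialCounts n) ℓ
      value free                = refl
      value jump                rewrite ℕ.*-zeroʳ L | ℕ.*-zeroʳ n | ℕ.*-zeroʳ m = refl
      value (counter (stack left)) rewrite ℕ.*-zeroʳ L | ℕ.*-zeroʳ n | ℕ.*-zeroʳ m = refl
      value (counter (stack right)) rewrite ℕ.*-zeroʳ L | ℕ.*-zeroʳ n | ℕ.*-zeroʳ m = refl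
      value (counter temp)      rewrite ℕ.*-zeroʳ L | ℕ.*-zeroʳ n | ℕ.*-zeroʳ m = refl
      value (counter spare)     rewrite ℕ.*-zeroʳ L | ℕ.*-zeroʳ m | ℕ.*-identityʳ n = ℕ.+-identityʳ n

    normalises : ∀ b w ls → kindsOf w ≡ concat texts ++ replicate n pad ++ end ∷ ls →
                 sweep (norm₀ b) w ≡ (norm₂ b , initialCells (kinds (length ls)))
    normalises b w ls eq with concat texts | texts-nonempty | codes
    ... | _ | κ , ks , refl | _ ∷ cs = trans
      (sweep-norm₀ b w κ (ks ++ replicate n pad) ls (All.++⁺ (All.map code≢end cs) (All.replicate⁺ n λ ()))
        (trans eq (cong (κ ∷_) (sym (++-assoc ks (replicate n pad) (end ∷ ls))))))
      (cong (λ xs → norm₂ b , initialCells (κ ∷ xs)) (++-assoc ks (replicate n pad) _))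

    module Run (Φ : ℕ → UState → List TaggedCell → Set)
      (back : ∀ m {q w q′} → turnU (finalState q w) ≡ just q′ → Φ m q′ (rewritten q w) → Φ m q w) where

      module E (m : ℕ) = Execution (Φ m) (back m) (padding m) (padding-nonempty m)

      -- The space bound b comes before the number m of vacant cells. So m can afterwards be chosen
      -- to meet it, although the run takes place in the segment given by m.
      G : Location → Counts → Set
      G s c = ∃ λ b → ∀ m f → E.Enough m b f → ∀ a → TextAt s a → E.AtAddress m a f c

      G-closed : Closed G
      G-closed = record
        { closed-inc  = λ { {s′ = s′} eq incr (b , g) → suc (address s′ + b) , λ m f en a t →
            E.at-inc m {a = a} t eq incr en λ f′ en′ → g m f′ en′ _ (textAt-address s′) }
        ; closed-transfer = λ { {s₁ = s₁} eq ci tr (b , g) → address s₁ + b , λ m f en a t →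
            E.at-transfer m {a = a} t eq ci tr en λ f′ en′ → g m f′ en′ _ (textAt-address s₁) }
        ; closed-fail = λ { {s₂ = s₂} eq ci (b , g) → address s₂ + b , λ m f en a t →
            E.at-transfer-fail m {a = a} t eq ci en λ f′ en′ → g m f′ en′ _ (textAt-address s₂) }
        }

      G-stop : (∀ m w → kindsOf w ≡ kinds m → Φ m (norm₀ false) w) → ∀ {s c} → instruction s ≡ stop → G s c
      G-stop at eq = 0 , λ m f en a t → E.at-stop m {a = a} t eq (at m)

      G-die : (∀ m → DeadHolds (Φ m)) → ∀ {s c} → instruction s ≡ die → G s c
      G-die dead eq = 0 , λ m f en a t → E.at-die m {a = a} t eq (dead m)

      run : G entry (initialCounts n) →
            ∃ λ b → ∀ m → DeadHolds (Φ m) ⊎ b ≤ m → Φ m (mark fetch) (initialCells (kinds m))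
      run (b , g) = b , λ m en → from m en (initial-valuation m)
        where
        from : ∀ m → DeadHolds (Φ m) ⊎ b ≤ m →
               (∃ λ f → m ≤ f × (∀ ℓ → occurrences ℓ (labels (initialCells (kinds m))) ≡ valuation f 0 (initialCounts n) ℓ)) →
               Φ m (mark fetch) (initialCells (kinds m))
        -- The mark of the initial word is on its first cell, where the copy of the entry's text at
        -- position 0 stands.
        from m en (f , m≤f , v) = g m f (Sum.map₂ (λ b≤m → ℕ.≤-trans b≤m m≤f) en) 0 refl
          .holds (initialCells (kinds m)) (tags-initial (kinds m)) v

    kindsOf-startCells : ∀ hs → kindsOf (startCells ++ hs) ≡ concat texts ++ replicate n pad ++ end ∷ kindsOf hs
    kindsOf-startCells hs = begin
      kindsOf (startCells ++ hs)           ≡⟨ cong (map proj₁) (map-++ proj₁ startCells hs) ⟩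
      map proj₁ (tags startCells ++ tags hs) ≡⟨ map-++ proj₁ (tags startCells) (tags hs) ⟩
      kindsOf startCells ++ kindsOf hs     ≡⟨ cong (_++ kindsOf hs) (kindsOf-initial (concat texts ++ replicate n pad ++ end ∷ [])) ⟩
      (concat texts ++ replicate n pad ++ end ∷ []) ++ kindsOf hs ≡⟨ ++-assoc (concat texts) _ (kindsOf hs) ⟩
      concat texts ++ (replicate n pad ++ end ∷ []) ++ kindsOf hs
        ≡⟨ cong (concat texts ++_) (++-assoc (replicate n pad) (end ∷ []) (kindsOf hs)) ⟩
      concat texts ++ replicate n pad ++ end ∷ kindsOf hs ∎
      where open ≡-Reasoning

    -- Reachability in second-order form: the initial situation lies in every predecessor-closed
    -- property that contains all situations at an instruction in `I`.
    Reaches : (Instruction Location → Set) → Set₁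
    Reaches I = ∀ G → Closed G → (∀ {s c} → I (instruction s) → G s c) → G entry (initialCounts n)

    startCells≢[] : startCells ≢ []
    startCells≢[] eq with trans (sym (proj₂ (proj₂ startCells-nonempty))) eq
    ... | ()

    dying⇒vanishes : Reaches (_≡ die) → Vanishes (norm₀ true) startCells
    dying⇒vanishes reaches = doomed⇒vanishes (norm₀ true) startCells startCells≢[] λ hs →
      doomed-start hs (cong (_++ hs) (proj₂ (proj₂ startCells-nonempty)))
      where
      Φ : ℕ → UState → List TaggedCell → Set
      -- Restricted to nonempty words, because an empty segment has no cell for a fault.
      Φ _ q w = ∀ {g gs} → w ≡ g ∷ gs → Doomed (start q w)
      back : ∀ m {q w q′} → turnU (finalState q w) ≡ just q′ → Φ m q′ (rewritten q w) → Φ m q w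
      back m {q} tq φ {g} {gs} refl = sweep-back Doomed evolve-doomed q (g ∷ gs) tq (φ refl)
      dead : ∀ m → DeadHolds (Φ m)
      dead m q _ tn {g} {gs} refl = sweep-dead q g gs tn
      open Run Φ back
      doomed : ∀ m → Φ m (mark fetch) (initialCells (kinds m))
      -- Running out of free cells is death as well, so `inj₁` serves in place of a space bound and
      -- every m is covered.
      doomed m = proj₂ (run (reaches G G-closed (G-die dead))) m (inj₁ (dead m))
      doomed-start : ∀ hs → Φ 0 (norm₀ true) (startCells ++ hs)
      doomed-start hs = back 0 (cong (turnU ∘ proj₁) norm) (subst (Φ 0 (mark fetch)) (sym (cong proj₂ norm)) (doomed (length (kindsOf hs))))
        where
        norm : sweep (norm₀ true) (startCells ++ hs) ≡ (norm₂ true , initialCells (kinds (length (kindsOf hs))))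
        norm = normalises true (startCells ++ hs) (kindsOf hs) (kindsOf-startCells hs)

    start-injective : ∀ {q q′ w} → Nonempty w → start q w ≡ start q′ w → q ≡ q′
    start-injective (g , gs , refl) refl = refl

    stopping⇒persists : Reaches (_≡ stop) → Persists (norm₀ true) startCells
    stopping⇒persists reaches = conclude fromFetch toFetch
      where
      Φ : ℕ → UState → List TaggedCell → Set
      Φ m q w = ∃ λ t → iterate evolve (start q w) t ≡ start (norm₀ true) (initialCells (kinds m))
      back : ∀ m {q w q′} → turnU (finalState q w) ≡ just q′ → Φ m q′ (rewritten q w) → Φ m q w
      back m {q} {w} tq = sweep-back (λ s → ∃ λ t → iterate evolve s t ≡ start (norm₀ true) (initialCells (kinds m)))
        (λ { (t , eq) → suc t , eq }) q w tq
      open Run Φ back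
      stopped : ∀ m w → kindsOf w ≡ kinds m → Φ m (norm₀ false) w
      stopped m w eq = back m (cong (turnU ∘ proj₁) norm)
        (0 , cong (start (norm₀ true)) (trans (cong proj₂ norm) (cong (initialCells ∘ kinds) (length-replicate m))))
        where
        norm : sweep (norm₀ false) w ≡ (norm₂ false , initialCells (kinds (length (replicate m vacant))))
        norm = normalises false w (replicate m vacant) eq
      result = run (reaches G G-closed (G-stop stopped))
      m : ℕ
      -- As many vacant cells as the run needs.
      m = proj₁ result
      w₀ : List TaggedCell
      w₀ = initialCells (kinds m)
      fromFetch : Φ m (mark fetch) w₀
      fromFetch = proj₂ result m (inj₂ ℕ.≤-refl)
      toFetch : ∃ λ t → iterate evolve (start (norm₀ true) w₀) t ≡ start (mark fetch) w₀
      toFetch = sweep-back (λ s → ∃ λ t → iterate evolve s t ≡ start (mark fetch) w₀) (λ { (t , eq) → suc t , eq }) (norm₀ true) w₀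
        (cong (turnU ∘ proj₁) norm) (0 , cong (start (mark fetch)) (trans (cong proj₂ norm) (cong (initialCells ∘ kinds) (length-replicate m))))
        where
        norm : sweep (norm₀ true) w₀ ≡ (norm₂ true , initialCells (kinds (length (replicate m vacant))))
        norm = normalises true w₀ (replicate m vacant) (kindsOf-initial (kinds m))
      conclude : Φ m (mark fetch) w₀ → (∃ λ t → iterate evolve (start (norm₀ true) w₀) t ≡ start (mark fetch) w₀) →
                 Persists (norm₀ true) startCells
      -- The period must be positive. The way to `fetch` takes at least one step because
      -- `norm₀ true` and `mark fetch` are different states on the same nonempty word.
      conclude _ (zero , eq₀) = contradiction
        (start-injective (subst Nonempty (sym (initialCells-kinds m)) (++-nonempty startCells-nonempty _)) eq₀) λ ()
      conclude (t , eq₁) (suc p , eq₀) = recurrent⇒persists (norm₀ true) startCells startCells≢[]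
        (map initialCell (replicate m vacant)) (p + t)
        (subst (λ w → iterate evolve (start (norm₀ true) w) (suc (p + t)) ≡ start (norm₀ true) w) (initialCells-kinds m)
          (trans (iterate-+ evolve (start (norm₀ true) w₀) (suc p) t) (trans (cong (λ s → iterate evolve s t) eq₀) eq₁)))

-- Turing machines as counter programs

-- In what follows a pair `p` supplies the other stack. Its component at `d` is overwritten, so
-- arguments such as `{0 , value rs}` have a placeholder there.
set : Direction → ℕ → ℕ × ℕ → ℕ × ℕ
set left  x (l , r) = x , r
set right x (l , r) = l , x

counts-stack : ∀ d v {p t n} → counts (set d v p) t n (stack d) ≡ v
counts-stack left  v = refl
counts-stack right v = refl

stack→temp : ∀ d {v p t n} → Transferred (stack d) temp (counts (set d (suc v) p) t n) (counts (set d v p) (suc t) n)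
stack→temp left  (stack left)  = refl
stack→temp left  (stack right) = refl
stack→temp left  temp          = refl
stack→temp left  spare         = refl
stack→temp right (stack left)  = refl
stack→temp right (stack right) = refl
stack→temp right temp          = refl
stack→temp right spare         = refl

temp→stack : ∀ d {v p t n} → Transferred temp (stack d) (counts (set d v p) (suc t) n) (counts (set d (suc v) p) t n)
temp→stack left  (stack left)  = refl
temp→stack left  (stack right) = refl
temp→stack left  temp          = refl
temp→stack left  spare         = refl
temp→stack right (stack left)  = refl
temp→stack right (stack right) = refl
temp→stack right temp          = refl
temp→stack right spare         = refl

stack→spare : ∀ d {v p t n} → Transferred (stack d) spare (counts (set d (suc v) p) t n) (counts (set d v p) t (suc n))
stack→spare left  (stack left)  = refl
stack→spare left  (stack right) = refl
stack→spare left  temp          = refl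
stack→spare left  spare         = refl
stack→spare right (stack left)  = refl
stack→spare right (stack right) = refl
stack→spare right temp          = refl
stack→spare right spare         = refl

spare→stack : ∀ d {v p t n} → Transferred spare (stack d) (counts (set d v p) t (suc n)) (counts (set d (suc v) p) t n)
spare→stack left  (stack left)  = refl
spare→stack left  (stack right) = refl
spare→stack left  temp          = refl
spare→stack left  spare         = refl
spare→stack right (stack left)  = refl
spare→stack right (stack right) = refl
spare→stack right temp          = refl
spare→stack right spare         = refl

inc-temp : ∀ {p t n} → Incremented temp (counts p t n) (counts p (suc t) n)
inc-temp (stack left)  = refl
inc-temp (stack right) = refl
inc-temp temp          = refl
inc-temp spare         = refl

finiteSymbol : ∀ k work → Finite (Symbol k work)
finiteSymbol k work = finiteRetract
  (λ { blank → inj₁ Fin.zero ; (input a) → inj₂ (inj₁ a) ; (aux i) → inj₂ (inj₂ i) })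
  (λ { (inj₁ _) → blank ; (inj₂ (inj₁ a)) → input a ; (inj₂ (inj₂ i)) → aux i })
  (λ { blank → refl ; (input a) → refl ; (aux i) → refl })
  (finite⊎ (finiteFin 1) (finite⊎ (finiteFin (suc k)) (finiteFin work)))

nextDigit : ∀ {n} → Fin n → Maybe (Fin n)
nextDigit {suc zero}    Fin.zero    = nothing
nextDigit {suc (suc n)} Fin.zero    = just (Fin.suc Fin.zero)
nextDigit               (Fin.suc i) = Maybe.map Fin.suc (nextDigit i)

nextDigit-inject₁ : ∀ {n} (i : Fin n) → nextDigit (inject₁ i) ≡ just (Fin.suc i)
nextDigit-inject₁ {suc n} Fin.zero    = refl
nextDigit-inject₁         (Fin.suc i) = cong (Maybe.map Fin.suc) (nextDigit-inject₁ i)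

nextDigit-fromℕ : ∀ n → nextDigit (fromℕ n) ≡ nothing
nextDigit-fromℕ zero    = refl
nextDigit-fromℕ (suc n) = cong (Maybe.map Fin.suc) (nextDigit-fromℕ n)

opposite : Direction → Direction
opposite left  = right
opposite right = left

module Compilation {k : ℕ} (T : TuringMachine k) (padLetter endLetter : Alphabet k) where
  open TuringMachine T using (states; work; action) renaming (start to initialState)

  base-1 : ℕ
  base-1 = suc k + work

  Digit : Set
  Digit = Fin (suc base-1)

  -- `finiteSymbol` lists `blank` first, so its digit is zero and the number 0 represents the empty
  -- stack as well as a stack of blanks. Popping an empty stack thus yields a blank, as moving past
  -- the end of a tape list does.
  digit : Symbol k work → Digit
  digit = index (finiteSymbol k work)

  symbol : Digit → Symbol k work
  symbol = element (finiteSymbol k work)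

  data StackState : Set where
    writeEnd pads writePad unwind : StackState
    rewind                        : Digit → StackState
    seek                          : Direction → Fin states → StackState
    run                           : Fin states → Digit → StackState

  data StackInstruction : Set where
    push   : Direction → Digit → StackState → StackInstruction
    pop    : Direction → (Digit → StackState) → StackInstruction
    refill : StackState → StackState → StackInstruction
    halt   : Bool → StackInstruction

  -- Letters of the input have nonzero digits, so the digit zero shows that the whole prefix has
  -- been unwound. Seeking to the right then puts the first letter under the head.
  unwound : Digit → StackState
  unwound Fin.zero    = seek right initialState
  unwound (Fin.suc x) = rewind (Fin.suc x)

  act : Action k states work → StackInstruction
  act (halt b)    = halt b
  act (go q s d) = push (opposite d) (digit s) (seek d q)

  -- The stacks hold the digits of the two sides of the tape.  The spare counter
  -- is the code of a prefix of the input as well as the number of pads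
  -- following it; refill copies it to the left stack while the pads are
  -- written, and then the prefix is unwound in front of them.
  stackInstruction : StackState → StackInstruction
  stackInstruction writeEnd   = push right (digit (input endLetter)) pads
  stackInstruction pads       = refill writePad unwind
  stackInstruction writePad   = push right (digit (input padLetter)) pads
  stackInstruction unwind     = pop left unwound
  stackInstruction (rewind x) = push right x unwind
  stackInstruction (seek d q) = pop d (run q)
  stackInstruction (run q x)  = act (action q (symbol x))

  -- To push x onto the stack v, temp is set to x + v * base and moved back; to
  -- pop, v is divided by base, with the quotient in temp, the remainder in the
  -- phase, and the other tokens dumped on spare, which is not read any more.
  data Phase : Set where
    add quotient restore : Digit → Phase
    back                 : Phase

  firstPhase : StackInstruction → Phase
  firstPhase (push d x s) = add x
  firstPhase (pop d f)    = quotient Fin.zero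
  firstPhase _            = back

  State : Set
  State = StackState × Phase

  enter : StackState → State
  enter s = s , firstPhase (stackInstruction s)

  divide : Direction → StackState → Digit → Maybe Digit → Instruction State
  divide d s x (just x′) = transfer (stack d) spare (s , quotient x′) (s , restore x)
  divide d s x nothing   = transfer (stack d) temp (s , quotient Fin.zero) (s , restore x)

  compile : StackState → StackInstruction → Phase → Instruction State
  -- The transfer supplies one of the `base` units of temp due for a unit of the stack; the phases
  -- from `fromℕ base-1` down to zero supply the others.
  compile s (push d x s′)  (add Fin.zero)    = transfer (stack d) temp (s , add (fromℕ base-1)) (s , back)
  compile s (push d x s′)  (add (Fin.suc i)) = inc temp (s , add (inject₁ i))
  compile s (push d x s′)  back              = transfer temp (stack d) (s , back) (enter s′)
  compile s (pop d f)      (quotient x)      = divide d s x (nextDigit x)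
  compile s (pop d f)      (restore x)       = transfer temp (stack d) (s , restore x) (enter (f x))
  compile s (refill s₁ s₂) _                 = transfer spare (stack left) (enter s₁) (enter s₂)
  compile s (halt false)   _                 = stop
  compile s _              _                 = die

  finiteStackState : Finite StackState
  finiteStackState = finiteRetract to from from-to
    (finite⊎ (finiteFin 4) (finite⊎ (finiteFin (suc base-1)) (finite⊎ (finite× finiteDirection (finiteFin states))
      (finite× (finiteFin states) (finiteFin (suc base-1))))))
    where
    to : StackState → Fin 4 ⊎ Digit ⊎ (Direction × Fin states) ⊎ (Fin states × Digit)
    to writeEnd   = inj₁ Fin.zero
    to pads       = inj₁ (Fin.suc Fin.zero)
    to writePad   = inj₁ (Fin.suc (Fin.suc Fin.zero))
    to unwind     = inj₁ (Fin.suc (Fin.suc (Fin.suc Fin.zero)))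
    to (rewind x) = inj₂ (inj₁ x)
    to (seek d q) = inj₂ (inj₂ (inj₁ (d , q)))
    to (run q x)  = inj₂ (inj₂ (inj₂ (q , x)))
    from : Fin 4 ⊎ Digit ⊎ (Direction × Fin states) ⊎ (Fin states × Digit) → StackState
    from (inj₁ Fin.zero)                         = writeEnd
    from (inj₁ (Fin.suc Fin.zero))               = pads
    from (inj₁ (Fin.suc (Fin.suc Fin.zero)))     = writePad
    from (inj₁ (Fin.suc (Fin.suc (Fin.suc _))))  = unwind
    from (inj₂ (inj₁ x))                         = rewind x
    from (inj₂ (inj₂ (inj₁ (d , q))))            = seek d q
    from (inj₂ (inj₂ (inj₂ (q , x))))            = run q x
    from-to : ∀ s → from (to s) ≡ s
    from-to writeEnd   = refl
    from-to pads       = refl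
    from-to writePad   = refl
    from-to unwind     = refl
    from-to (rewind x) = refl
    from-to (seek d q) = refl
    from-to (run q x)  = refl

  finitePhase : Finite Phase
  finitePhase = finiteRetract
    (λ { back → inj₁ Fin.zero ; (add x) → inj₂ (inj₁ x) ; (quotient x) → inj₂ (inj₂ (inj₁ x)) ; (restore x) → inj₂ (inj₂ (inj₂ x)) })
    (λ { (inj₁ _) → back ; (inj₂ (inj₁ x)) → add x ; (inj₂ (inj₂ (inj₁ x))) → quotient x ; (inj₂ (inj₂ (inj₂ x))) → restore x })
    (λ { back → refl ; (add x) → refl ; (quotient x) → refl ; (restore x) → refl })
    (finite⊎ (finiteFin 1) (finite⊎ (finiteFin (suc base-1)) (finite⊎ (finiteFin (suc base-1)) (finiteFin (suc base-1)))))

  program : Program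
  program = record
    { Location    = State
    ; locations   = finite× finiteStackState finitePhase
    ; entry       = enter writeEnd
    ; instruction = λ { (s , φ) → compile s (stackInstruction s) φ }
    }

  open Program program using (instruction)

  base : ℕ
  base = suc base-1

  value : List (Symbol k work) → ℕ
  value []       = 0
  value (x ∷ xs) = toℕ (digit x) + value xs * base

  module Simulation (G : State → Counts → Set) (closed : Closed program G) where
    open Closed closed

    module Push {s d x s′} (eq : stackInstruction s ≡ push d x s′) where

      pushed : ∀ t v {p n} → G (enter s′) (counts (set d (t + v) p) 0 n) → G (s , back) (counts (set d v p) t n)
      pushed zero    v g = closed-fail (cong (λ i → compile s i back) eq) refl g
      pushed (suc t) v {p} {n} g = closed-transfer (cong (λ i → compile s i back) eq) refl (temp→stack d)
        (pushed t (suc v) (subst (λ m → G (enter s′) (counts (set d m p) 0 n)) (sym (ℕ.+-suc t v)) g))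

      added : ∀ m (i : Digit) → toℕ i ≡ m → ∀ {t p n} → G (s , add Fin.zero) (counts p (m + t) n) → G (s , add i) (counts p t n)
      added zero    Fin.zero    _   g = g
      added (suc m) (Fin.suc i) i≡m {t} {p} {n} g = closed-inc (cong (λ j → compile s j (add (Fin.suc i))) eq) inc-temp
        (added m (inject₁ i) (trans (Fin.toℕ-inject₁ i) (ℕ.suc-injective i≡m))
          (subst (λ t → G (s , add Fin.zero) (counts p t n)) (sym (ℕ.+-suc m t)) g))

      multiplied : ∀ v {t p n} → G (s , back) (counts (set d 0 p) (t + v * base) n) → G (s , add Fin.zero) (counts (set d v p) t n)
      multiplied zero {t} {p} {n} g = closed-fail (cong (λ i → compile s i (add Fin.zero)) eq) (counts-stack d 0)
        (subst (λ t → G (s , back) (counts (set d 0 p) t n)) (ℕ.+-identityʳ t) g)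
      multiplied (suc v) {t} {p} {n} g = closed-transfer (cong (λ i → compile s i (add Fin.zero)) eq) (counts-stack d (suc v)) (stack→temp d)
        (added base-1 (fromℕ base-1) (Fin.toℕ-fromℕ base-1)
          (multiplied v (subst (λ t → G (s , back) (counts (set d 0 p) t n)) arithmetic g)))
        where
        arithmetic : t + (base + v * base) ≡ base-1 + suc t + v * base
        arithmetic = trans (sym (ℕ.+-assoc t base (v * base)))
          (cong (_+ v * base) (trans (ℕ.+-comm t base) (sym (ℕ.+-suc base-1 t))))

      after-push : ∀ v {p n} → G (enter s′) (counts (set d (toℕ x + v * base) p) 0 n) → G (enter s) (counts (set d v p) 0 n)
      after-push v {p} {n} g = subst (λ i → G (s , firstPhase i) (counts (set d v p) 0 n)) (sym eq)
        (added (toℕ x) x refl (multiplied v (pushed (toℕ x + 0 + v * base) 0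
          (subst (λ m → G (enter s′) (counts (set d m p) 0 n))
            (sym (trans (ℕ.+-identityʳ _) (cong (_+ v * base) (ℕ.+-identityʳ (toℕ x))))) g))))

    open Push using (after-push)

    module Pop {s d f} (eq : stackInstruction s ≡ pop d f) where

      restored : ∀ x t v {p} → (∀ n → G (enter (f x)) (counts (set d (t + v) p) 0 n)) →
                 ∀ n → G (s , restore x) (counts (set d v p) t n)
      restored x zero    v g n = closed-fail (cong (λ i → compile s i (restore x)) eq) refl (g n)
      restored x (suc t) v {p} g n = closed-transfer (cong (λ i → compile s i (restore x)) eq) refl (temp→stack d)
        (restored x t (suc v) (λ n → subst (λ m → G (enter (f x)) (counts (set d m p) 0 n)) (sym (ℕ.+-suc t v)) (g n)) n)

      counted : ∀ m (x : Digit) → toℕ x ≡ m → ∀ v {t p} → (∀ n → G (s , quotient x) (counts (set d v p) t n)) →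
                ∀ n → G (s , quotient Fin.zero) (counts (set d (m + v) p) t n)
      counted zero    Fin.zero    _   v g n = g n
      counted (suc m) (Fin.suc x) x≡m v {t} {p} g n =
        subst (λ w → G (s , quotient Fin.zero) (counts (set d w p) t n)) (ℕ.+-suc m v)
          (counted m (inject₁ x) (trans (Fin.toℕ-inject₁ x) (ℕ.suc-injective x≡m)) (suc v) {t} {p}
            (λ n → closed-transfer
              (trans (cong (λ i → compile s i (quotient (inject₁ x))) eq) (cong (divide d s (inject₁ x)) (nextDigit-inject₁ x)))
              (counts-stack d (suc v)) (stack→spare d) (g (suc n))) n)

      divided : ∀ v w {t p} → (∀ n → G (s , quotient Fin.zero) (counts (set d w p) (v + t) n)) →
                ∀ n → G (s , quotient Fin.zero) (counts (set d (v * base + w) p) t n)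
      divided zero    w g n = g n
      divided (suc v) w {t} {p} g n =
        subst (λ x → G (s , quotient Fin.zero) (counts (set d x p) t n)) arithmetic
          (counted base-1 (fromℕ base-1) (Fin.toℕ-fromℕ base-1) (suc (v * base + w)) {t} {p}
            (λ n → closed-transfer
              (trans (cong (λ i → compile s i (quotient (fromℕ base-1))) eq) (cong (divide d s (fromℕ base-1)) (nextDigit-fromℕ base-1)))
              (counts-stack d (suc (v * base + w))) (stack→temp d)
              (divided v w {suc t} {p} (λ n → subst (λ t → G (s , quotient Fin.zero) (counts (set d w p) t n)) (sym (ℕ.+-suc v t)) (g n)) n)) n)
        where
        arithmetic : base-1 + suc (v * base + w) ≡ base + v * base + w
        arithmetic = trans (ℕ.+-suc base-1 (v * base + w)) (sym (ℕ.+-assoc base (v * base) w))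

      remainder : ∀ x t {p} → (∀ n → G (s , restore x) (counts (set d 0 p) t n)) →
                  ∀ n → G (s , quotient x) (counts (set d 0 p) t n)
      remainder x t {p} g n = exhausted (nextDigit x) refl
        where
        exhausted : ∀ x′ → nextDigit x ≡ x′ → G (s , quotient x) (counts (set d 0 p) t n)
        exhausted (just x′) eq′ = closed-fail (trans (cong (λ i → compile s i (quotient x)) eq) (cong (divide d s x) eq′)) (counts-stack d 0) (g n)
        exhausted nothing   eq′ = closed-fail (trans (cong (λ i → compile s i (quotient x)) eq) (cong (divide d s x) eq′)) (counts-stack d 0) (g n)

      -- The stack gives up complete groups of `base` units, each leaving one unit on temp, and then
      -- the remainder `x`. What has been dumped on spare is not tracked, hence the quantification
      -- over n on both sides.
      after-pop : ∀ x v {p} → (∀ n → G (enter (f x)) (counts (set d v p) 0 n)) →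
                  ∀ n → G (enter s) (counts (set d (toℕ x + v * base) p) 0 n)
      after-pop x v {p} g n = subst (λ i → G (s , firstPhase i) (counts (set d (toℕ x + v * base) p) 0 n)) (sym eq)
        (subst (λ m → G (s , quotient Fin.zero) (counts (set d m p) 0 n)) (ℕ.+-comm (v * base) (toℕ x))
          (divided v (toℕ x) {0} {p} (λ n → subst (λ m → G (s , quotient Fin.zero) (counts (set d m p) (v + 0) n)) (ℕ.+-identityʳ (toℕ x))
            (counted (toℕ x) x refl 0 {v + 0} {p} (remainder x (v + 0) {p}
              (restored x (v + 0) 0 {p} λ n → subst (λ m → G (enter (f x)) (counts (set d m p) 0 n))
                (sym (trans (ℕ.+-identityʳ (v + 0)) (ℕ.+-identityʳ v))) (g n))) n)) n))

    open Pop using (after-pop)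

    Final : Bool → Set
    Final b = ∀ {s c} → instruction s ≡ (if b then die else stop) → G s c

    run-instruction : ∀ q h → stackInstruction (run q (digit h)) ≡ act (action q h)
    run-instruction q h = cong (λ h → act (action q h)) (element-index (finiteSymbol k work) h)

    -- The scanned symbol is part of the location. A move pushes the written symbol on the side left
    -- behind and pops the next one from the side ahead, which yields a blank if that side is empty.
    simulate : ∀ {b} → Final b → ∀ {q ls h rs} → HaltsFrom T q (tape ls h rs) b →
               ∀ n → G (enter (run q (digit h))) (counts (value ls , value rs) 0 n)
    simulate {b} final {q} {h = h} (stop eq) n = final (halting b (trans (run-instruction q h) (cong act eq)))
      where
      halting : ∀ b {i φ s} → i ≡ halt b → compile s i φ ≡ (if b then die else stop)
      halting true  refl = refl
      halting false refl = refl
    simulate final {q} {ls} {h} {[]} (step {q′} {s} {right} eq r) n =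
      after-push (trans (run-instruction q h) (cong act eq)) (value ls) {0 , 0}
        (after-pop {seek right q′} refl (digit blank) 0 {value (s ∷ ls) , 0} (simulate final r) n)
    simulate final {q} {ls} {h} {x ∷ rs} (step {q′} {s} {right} eq r) n =
      after-push (trans (run-instruction q h) (cong act eq)) (value ls) {0 , value (x ∷ rs)}
        (after-pop {seek right q′} refl (digit x) (value rs) {value (s ∷ ls) , 0} (simulate final r) n)
    simulate final {q} {[]} {h} {rs} (step {q′} {s} {left} eq r) n =
      after-push (trans (run-instruction q h) (cong act eq)) (value rs) {0 , 0}
        (after-pop {seek left q′} refl (digit blank) 0 {0 , value (s ∷ rs)} (simulate final r) n)
    simulate final {q} {x ∷ ls} {h} {rs} (step {q′} {s} {left} eq r) n =
      after-push (trans (run-instruction q h) (cong act eq)) (value rs) {value (x ∷ ls) , 0}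
        (after-pop {seek left q′} refl (digit x) (value ls) {0 , value (s ∷ rs)} (simulate final r) n)

    padSymbol endSymbol : Symbol k work
    padSymbol = input padLetter
    endSymbol = input endLetter

    replicate-∷ : ∀ {A : Set} j (x : A) xs → replicate j x ++ x ∷ xs ≡ x ∷ replicate j x ++ xs
    replicate-∷ zero    x xs = refl
    replicate-∷ (suc j) x xs = cong (x ∷_) (replicate-∷ j x xs)

    fill : ∀ j l rs → G (enter unwind) (counts (j + l , value (replicate j padSymbol ++ rs)) 0 0) →
           G (enter pads) (counts (l , value rs) 0 j)
    fill zero    l rs g = closed-fail refl refl g
    fill (suc j) l rs g = closed-transfer refl refl (spare→stack left {p = l , value rs})
      (after-push {writePad} refl (value rs) {suc l , 0}
        (fill j (suc l) (padSymbol ∷ rs) (subst₂ (λ m xs → G (enter unwind) (counts (m , value xs) 0 0))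
          (sym (ℕ.+-suc j l)) (sym (replicate-∷ j padSymbol rs)) g)))

    unwinding : ∀ u rs → (∀ n → G (enter (seek right initialState)) (counts (0 , value (map input u ʳ++ rs)) 0 n)) →
                ∀ n → G (enter unwind) (counts (value (map input u) , value rs) 0 n)
    unwinding []      rs g = after-pop {unwind} refl Fin.zero 0 {0 , value rs} g
    unwinding (a ∷ u) rs g = after-pop {unwind} refl (digit (input a)) (value (map input u)) {0 , value rs}
      λ n → after-push {rewind (digit (input a))} refl (value rs) {value (map input u) , 0}
        (unwinding u (input a ∷ rs) g n)

    load : ∀ {b} → Final b → ∀ u → let n = value (map input (reverse u)) in
           ∀ v → v ≡ u ++ replicate n padLetter ++ endLetter ∷ [] → Outputs T v b →
           G (enter writeEnd) (initialCounts n)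
    load {b} final u v eq out = after-push {writeEnd} refl 0 {0 , 0}
      (fill n 0 (endSymbol ∷ []) (subst (λ m → G (enter unwind) (counts (m , value pads′) 0 0)) (sym (ℕ.+-identityʳ n))
        (unwinding (reverse u) pads′ (λ n → subst (λ xs → G (enter (seek right initialState)) (counts (0 , value xs) 0 n)) (sym contents)
          (launch v out n)) 0)))
      where
      n : ℕ
      n = value (map input (reverse u))
      pads′ : List (Symbol k work)
      pads′ = replicate n padSymbol ++ endSymbol ∷ []
      contents : map input (reverse u) ʳ++ pads′ ≡ map input v
      contents = begin
        map input (reverse u) ʳ++ pads′         ≡⟨ ʳ++-defn (map input (reverse u)) ⟩
        reverse (map input (reverse u)) ++ pads′ ≡⟨ cong (_++ pads′) (sym (reverse-map input (reverse u))) ⟩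
        map input (reverse (reverse u)) ++ pads′ ≡⟨ cong (λ w → map input w ++ pads′) (reverse-involutive u) ⟩
        map input u ++ pads′                    ≡⟨ cong (map input u ++_) (cong (_++ endSymbol ∷ []) (sym (map-replicate input n padLetter))) ⟩
        map input u ++ map input (replicate n padLetter) ++ map input (endLetter ∷ [])
          ≡⟨ cong (map input u ++_) (sym (map-++ input (replicate n padLetter) (endLetter ∷ []))) ⟩
        map input u ++ map input (replicate n padLetter ++ endLetter ∷ []) ≡⟨ map-++ input u _ ⟨
        map input (u ++ replicate n padLetter ++ endLetter ∷ [])          ≡⟨ cong (map input) eq ⟨
        map input v                              ∎
        where open ≡-Reasoning
      launch : ∀ v → Outputs T v b → ∀ n → G (enter (seek right initialState)) (counts (0 , value (map input v)) 0 n)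
      launch []      r = after-pop {seek right initialState} refl (digit blank) 0 {0 , 0} (simulate final r)
      launch (a ∷ v) r = after-pop {seek right initialState} refl (digit (input a)) (value (map input v)) {0 , 0} (simulate final r)

-- The diagonal word

cellLetter : Kind → Alphabet k
cellLetter κ = encode (afterHead (initialCell κ))

startWord-initial : ∀ q {ks} → Nonempty ks → ∀ ls →
  startWord q (initialCells (ks ++ ls)) ≡ startWord q (initialCells ks) ++ map cellLetter ls
startWord-initial q (κ , ks , refl) ls = cong (λ w → Fin.zero ∷ encode _ ∷ w) (begin
  map encode (map afterHead (map initialCell (ks ++ ls))) ≡⟨ map-∘ (map initialCell (ks ++ ls)) ⟨
  map (encode ∘ afterHead) (map initialCell (ks ++ ls))   ≡⟨ map-∘ (ks ++ ls) ⟨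
  map cellLetter (ks ++ ls)                           ≡⟨ map-++ cellLetter ks ls ⟩
  map cellLetter ks ++ map cellLetter ls              ≡⟨ cong (_++ map cellLetter ls) (trans (map-∘ ks) (map-∘ (map initialCell ks))) ⟩
  map encode (map afterHead (map initialCell ks)) ++ map cellLetter ls ∎)
  where open ≡-Reasoning

module DiagonalWord (T : TuringMachine k) where
  open Compilation T (cellLetter pad) (cellLetter end) public
  open Program program using (texts)

  codeWord : Word k
  codeWord = startWord (norm₀ true) (initialCells (concat texts))

  -- Reversed because the top of a stack is its lowest digit: the last letter of the prefix must
  -- come off the left stack first, to end up next to the pads on the right stack.
  pads-needed : ℕ
  pads-needed = value (map input (reverse codeWord))

  word : Word k
  word = startWord (norm₀ true) (startCells program pads-needed)

  -- Past its first cell, the letter of a cell of the start word depends on the kind alone. Pads and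
  -- end marker are therefore fixed letters, which can be given to the program before the word is
  -- known.
  word-letters : word ≡ codeWord ++ replicate pads-needed (cellLetter pad) ++ cellLetter end ∷ []
  word-letters = trans
    (startWord-initial (norm₀ true) (texts-nonempty program pads-needed) (replicate pads-needed pad ++ end ∷ []))
    (cong (codeWord ++_) (trans (map-++ cellLetter (replicate pads-needed pad) (end ∷ []))
      (cong (_++ cellLetter end ∷ []) (map-replicate cellLetter pads-needed pad))))

  reaches : ∀ {b} → Outputs T word b → Reaches program pads-needed (_≡ (if b then die else stop))
  reaches out G closed final = Simulation.load G closed final codeWord word word-letters out

  diagonal : Diagonal T (norm₀ true) (startCells program pads-needed)
  diagonal = (λ out → dying⇒vanishes program pads-needed (reaches {true} out)) ,
             (λ out → stopping⇒persists program pads-needed (reaches {false} out))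

mainTheorem6 : ∃ λ (A : CellularAutomaton) → ¬ Recursive (persistent A (uniform (size-1 A)))
mainTheorem6 = automaton , diagonalisation λ T →
  norm₀ true , startCells (program T) (pads-needed T) , diagonal T
  where open DiagonalWord
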